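{- Consider the problem $\mathbf{DCM}$ and the shortest-path algorithm described in the context. The algorithm finds an optimal solution to $\mathbf{DCM}$ in time $$O\left(M^{2}N^{2}T\log\left(MNT\right)\right),$$ where $T$ is the number of slots, $N$ is the number of generators and $M=\max_{1\leq t\leq T}\lceil a(t)\rceil$.
   Context: Notation: $[z]^+=\max(0,z)$; $\mathbb{N}^0$ is the set of non-negative integers. Time is slotted, $t=1,\dots,T$. Parameters: number of on-site generators $N$; generator capacity $L>0$; incremental generation cost $c_o\ge 0$ per unit energy; sunk cost $c_m\ge0$ per active generator per slot; generator startup cost $\beta_g>0$; server switching cost $\beta_s>0$; price bounds $0\le P_{\min}\le P_{\max}$; it is assumed that $c_o+c_m/L<P_{\max}$. Inputs: workload $a(t)\ge 0$, grid price $p(t)\in[P_{\min},P_{\max}]$, and total power consumption functions $g_t(x,a)\ge0$, increasing (non-decreasing) and convex in $x$ and $a$. Put $d_t(x)=g_t(x,a(t))$. Define $$\psi(y,p,d)=\begin{cases} c_m y+p\,d, & p\le c_o,\\ c_m y+c_oLy+p(d-Ly), & p>c_o \text{ and } d>Ly,\\ c_m y+c_o d, & \text{otherwise.}\end{cases}$$ Problem $\mathbf{DCM}$: minimize $$\sum_{t=1}^{T}\left\{\psi(y(t),p(t),d_t(x(t)))+\beta_s[x(t)-x(t-1)]^+ +\beta_g[y(t)-y(t-1)]^+\right\}$$ over $x(t),y(t)\in\mathbb{N}^0$, $t=1,\dots,T$, subject to $x(t)\ge a(t)$, $y(t)\le N$, $x(0)=y(0)=0$. Algorithm: build a directed graph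 whose vertices $\langle x,y,t\rangle$ represent the possible states with $x$ active servers and $y$ active generators at time $t$ (with $0\le x\le M$, $0\le y\le N$, and $x\ge a(t)$ for $1\le t\le T$), including an initial vertex $\langle 0,0,0\rangle$ and a final vertex $\langle 0,0,T+1\rangle$. Draw an edge from each vertex $\langle x(t-1),y(t-1),t-1\rangle$ to each possible vertex $\langle x(t),y(t),t\rangle$, with weight $\psi(y(t),p(t),d_t(x(t)))+\beta_s[x(t)-x(t-1)]^+ +\beta_g[y(t)-y(t-1)]^+$ (edges into the final vertex at time $T+1$ have weight $0$). Run Dijkstra's algorithm to find a minimum-weight path from $\langle0,0,0\rangle$ to $\langle0,0,T+1\rangle$, and output the sequence $(x(t),y(t))_{t=1}^T$ along that path. Evaluations of edge weights are counted as constant-time operations. -}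

module Defs where

open import Level using (Level; _⊔_) renaming (suc to lsuc)
open import Algebra.Bundles using (CommutativeRing)
import Algebra.Definitions.RawMonoid as RawMonoidMultiples
open import Data.Bool.Base using (Bool; true; false; if_then_else_)
open import Data.List.Base using (List; []; _∷_; length; applyUpTo; foldr)
open import Data.List.Extrema.Nat using (max)
open import Data.Maybe.Base using (Maybe; just; nothing)
open import Data.Nat.Base as ℕ using (ℕ; zero; suc)
import Data.Nat.Properties as ℕ
open import Data.Product.Base using (Σ-syntax; _×_; _,_; proj₁; proj₂)
open import Data.Product.Properties using (≡-dec)
open import Relation.Binary.Core using (Rel)
open import Relation.Binary.Definitions using (Decidable; DecidableEquality)
open import Relation.Binary.PropositionalEquality.Core using (_≡_)
open import Relation.Binary.Structures using (IsDecTotalOrder)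
import Relation.Binary.Construct.NonStrictToStrict as NonStrictToStrict
open import Relation.Nullary.Decidable.Core using (does)
open import Relation.Nullary.Negation.Core using (¬_)

-- The real numbers enter only through this structure: a model of ℝ in which
-- comparison is decidable (as in the real-RAM model) is an instance.
record ArchimedeanOrderedField (c ℓ₁ ℓ₂ : Level) : Set (lsuc (c ⊔ ℓ₁ ⊔ ℓ₂)) where
  field
    commutativeRing : CommutativeRing c ℓ₁

  open CommutativeRing commutativeRing public hiding (zero)
  open RawMonoidMultiples +-rawMonoid using () renaming (_×_ to _·_)

  infix 4 _≤_ _<_ _<?_
  infix 9 _⁻¹

  field
    _≤_             : Rel Carrier ℓ₂
    isDecTotalOrder : IsDecTotalOrder _≈_ _≤_
    +-monoˡ-≤       : ∀ {x y} z → x ≤ y → x + z ≤ y + z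
    *-nonNegative   : ∀ {x y} → 0# ≤ x → 0# ≤ y → 0# ≤ x * y
    0≉1             : ¬ 0# ≈ 1#
    _⁻¹             : Carrier → Carrier
    *-inverseʳ      : ∀ x → ¬ x ≈ 0# → x * x ⁻¹ ≈ 1#
    archimedean     : ∀ x → Σ[ n ∈ ℕ ] x ≤ n · 1#

  open IsDecTotalOrder isDecTotalOrder public using (_≤?_; _≟_)

  _<_ : Rel Carrier (ℓ₁ ⊔ ℓ₂)
  _<_ = NonStrictToStrict._<_ _≈_ _≤_

  _<?_ : Decidable _<_
  _<?_ = NonStrictToStrict.<-decidable _≈_ _≤_ _≟_ _≤?_

  fromℕ : ℕ → Carrier
  fromℕ n = n · 1#

  [_]⁺ : Carrier → Carrier
  [ z ]⁺ = if does (0# ≤? z) then z else 0#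

  -- The least k ≤ n with x ≤ fromℕ k, provided that x ≤ fromℕ n.
  leastBound : Carrier → ℕ → ℕ
  leastBound x zero    = zero
  leastBound x (suc n) = if does (x ≤? fromℕ n) then leastBound x n else suc n

  -- The ceiling of a non-negative x (negative x are sent to 0).
  ⌈_⌉ : Carrier → ℕ
  ⌈ x ⌉ = leastBound x (proj₁ (archimedean x))

-- Computations with a step count.  In every program below each clause of each
-- function spends one step and, apart from calls to other such programs, does
-- a bounded number of unit-cost operations (comparison and arithmetic of
-- indices or field elements, evaluation of an edge weight, (de)construction).
record Timed {a} (A : Set a) : Set a where
  constructor timed
  field
    value : A
    steps : ℕ

open Timed public

private
  variable
    ℓ ℓ′ : Level
    A : Set ℓ
    B : Set ℓ′

return : A → Timed A
return x = timed x 0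

spend : ℕ → Timed A → Timed A
spend n m = timed (value m) (n ℕ.+ steps m)

tick : Timed A → Timed A
tick = spend 1

infixl 1 _>>=_

_>>=_ : Timed A → (A → Timed B) → Timed B
m >>= f = spend (steps m) (f (value m))

lengthᵗ : List A → Timed ℕ
lengthᵗ []       = tick (return 0)
lengthᵗ (_ ∷ xs) = tick do
  n ← lengthᵗ xs
  return (suc n)

reverseOnto : List A → List A → Timed (List A)
reverseOnto acc []       = tick (return acc)
reverseOnto acc (x ∷ xs) = tick (reverseOnto (x ∷ acc) xs)

dropLast : List A → Timed (List A)
dropLast []           = tick (return [])
dropLast (x ∷ [])     = tick (return [])
dropLast (x ∷ y ∷ xs) = tick do
  zs ← dropLast (y ∷ xs)
  return (x ∷ zs)

-- Random-access memory indexed by I: reading and writing a cell take one step,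
-- initialising a block of n cells takes n steps.
module Memory {i} {I : Set i} (_≟ᴵ_ : DecidableEquality I) where

  Array : ∀ {a} → Set a → Set (i ⊔ a)
  Array A = I → A

  newArray : ℕ → A → Timed (Array A)
  newArray n x = spend n (return λ _ → x)

  read : Array A → I → Timed A
  read arr j = tick (return (arr j))

  write : Array A → I → A → Timed (Array A)
  write arr j x = tick (return λ k → if does (k ≟ᴵ j) then x else arr k)

module ShortestPath {c ℓ₁ ℓ₂} (F : ArchimedeanOrderedField c ℓ₁ ℓ₂)
                    {v} {V : Set v} (_≟ⱽ_ : DecidableEquality V) where

  open ArchimedeanOrderedField F
  open Memory _≟ⱽ_

  record Edge : Set (c ⊔ v) where
    constructor edge
    field
      source target : V
      weight        : Carrier

  -- A candidate path: its end vertex, the predecessors of that vertex with the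
  -- nearest one first, and its weight.  The list of predecessors plays the role
  -- of the usual parent pointers.
  record Entry : Set (c ⊔ v) where
    constructor entry
    field
      dist   : Carrier
      vertex : V
      trail  : List V

  open Entry

  -- Leftist heaps: the number in a node is the length of its right spine.
  data Heap : Set (c ⊔ v) where
    empty : Heap
    node  : ℕ → Entry → Heap → Heap → Heap

  rank : Heap → ℕ
  rank empty          = 0
  rank (node n _ _ _) = n

  makeNode : Entry → Heap → Heap → Timed Heap
  makeNode e l r = tick (return (
    if rank r ℕ.≤ᵇ rank l
      then node (suc (rank r)) e l r
      else node (suc (rank l)) e r l))

  merge : Heap → Heap → Timed Heap
  merge empty h₂ = tick (return h₂)
  merge h₁@(node _ _ _ _) empty = tick (return h₁)
  merge h₁@(node _ e₁ l₁ r₁) h₂@(node _ e₂ l₂ r₂) = tick (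
    if does (dist e₁ ≤? dist e₂)
      then (merge r₁ h₂ >>= λ r → makeNode e₁ l₁ r)
      else (merge h₁ r₂ >>= λ r → makeNode e₂ l₂ r))

  insert : Entry → Heap → Timed Heap
  insert e h = tick (merge (node 1 e empty empty) h)

  Adjacency : Set (c ⊔ v)
  Adjacency = Array (List (V × Carrier))

  addEdges : List Edge → Adjacency → Timed Adjacency
  addEdges []                adj = tick (return adj)
  addEdges (edge s t w ∷ es) adj = tick do
    out  ← read adj s
    adj′ ← write adj s ((t , w) ∷ out)
    addEdges es adj′

  relax : Entry → List (V × Carrier) → Heap → Timed Heap
  relax e []              h = tick (return h)
  relax e ((u , w) ∷ out) h = tick do
    h′ ← insert (entry (dist e + w) u (vertex e ∷ trail e)) h
    relax e out h′

  -- The first argument bounds the number of extractions from the queue.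
  settle : ℕ → Adjacency → V → Array Bool → Heap → Timed (Maybe (List V))
  settle zero    adj goal settled h              = tick (return nothing)
  settle (suc n) adj goal settled empty          = tick (return nothing)
  settle (suc n) adj goal settled (node _ e l r) = tick do
    rest ← merge l r
    done ← read settled (vertex e)
    if done
      then settle n adj goal settled rest
      else if does (vertex e ≟ⱽ goal)
        then (do
          path ← reverseOnto [] (vertex e ∷ trail e)
          return (just path))
        else (do
          settled′ ← write settled (vertex e) true
          out      ← read adj (vertex e)
          rest′    ← relax e out rest
          settle n adj goal settled′ rest′)

  -- Dijkstra's algorithm with a leftist heap as priority queue and lazy deletion,
  -- on a graph given by its list of edges; `size` is the number of cells needed
  -- for an array indexed by the vertices.  Besides the start vertex, each edge
  -- enters the queue at most once, which bounds the number of extractions.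
  dijkstra : (size : ℕ) → List Edge → (start goal : V) → Timed (Maybe (List V))
  dijkstra size es start goal = tick do
    adj₀    ← newArray size []
    adj     ← addEdges es adj₀
    settled ← newArray size false
    n       ← lengthᵗ es
    queue   ← insert (entry 0# start []) empty
    settle (suc n) adj goal settled queue

State : Set
State = ℕ × ℕ

Vertex : Set
Vertex = ℕ × ℕ × ℕ

pattern ⟨_,_,_⟩ x y t = x , y , t

_≟ⱽ_ : DecidableEquality Vertex
_≟ⱽ_ = ≡-dec ℕ._≟_ (≡-dec ℕ._≟_ ℕ._≟_)

module DataCentre {c ℓ₁ ℓ₂} (F : ArchimedeanOrderedField c ℓ₁ ℓ₂) where

  open ArchimedeanOrderedField F

  MonotoneOn≥0 : (Carrier → Carrier) → Set (c ⊔ ℓ₂)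
  MonotoneOn≥0 f = ∀ u v → 0# ≤ u → u ≤ v → f u ≤ f v

  ConvexOn≥0 : (Carrier → Carrier) → Set (c ⊔ ℓ₂)
  ConvexOn≥0 f = ∀ u v θ → 0# ≤ u → 0# ≤ v → 0# ≤ θ → θ ≤ 1# →
    f (θ * u + (1# - θ) * v) ≤ θ * f u + (1# - θ) * f v

  -- Time-dependent data are indexed by ℕ, but only slots 1, …, T matter.
  record DCM : Set (c ⊔ ℓ₁ ⊔ ℓ₂) where
    field
      T N         : ℕ
      L cₒ cₘ     : Carrier
      βg βs       : Carrier
      Pmin Pmax   : Carrier
      a p         : ℕ → Carrier
      g           : ℕ → Carrier → Carrier → Carrier

    Slot : ℕ → Set
    Slot t = 1 ℕ.≤ t × t ℕ.≤ T

    field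
      L>0         : 0# < L
      cₒ≥0        : 0# ≤ cₒ
      cₘ≥0        : 0# ≤ cₘ
      βg>0        : 0# < βg
      βs>0        : 0# < βs
      Pmin≥0      : 0# ≤ Pmin
      Pmin≤Pmax   : Pmin ≤ Pmax
      cₒ+cₘ/L<Pmax : cₒ + cₘ * L ⁻¹ < Pmax
      a≥0         : ∀ t → Slot t → 0# ≤ a t
      p≥Pmin      : ∀ t → Slot t → Pmin ≤ p t
      p≤Pmax      : ∀ t → Slot t → p t ≤ Pmax
      g≥0         : ∀ t → Slot t → ∀ x b → 0# ≤ x → 0# ≤ b → 0# ≤ g t x b
      g-monotone₁ : ∀ t → Slot t → ∀ b → 0# ≤ b → MonotoneOn≥0 (λ x → g t x b)
      g-monotone₂ : ∀ t → Slot t → ∀ x → 0# ≤ x → MonotoneOn≥0 (g t x)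
      g-convex₁   : ∀ t → Slot t → ∀ b → 0# ≤ b → ConvexOn≥0 (λ x → g t x b)
      g-convex₂   : ∀ t → Slot t → ∀ x → 0# ≤ x → ConvexOn≥0 (g t x)

    d : ℕ → ℕ → Carrier
    d t x = g t (fromℕ x) (a t)

    ψ : ℕ → Carrier → Carrier → Carrier
    ψ y price demand =
      if does (price ≤? cₒ) then
        cₘ * Y + price * demand
      else if does (L * Y <? demand) then
        cₘ * Y + cₒ * L * Y + price * (demand - L * Y)
      else
        cₘ * Y + cₒ * demand
      where Y = fromℕ y

    stepCost : State → State → ℕ → Carrier
    stepCost (x′ , y′) (x , y) t =
      ψ y (p t) (d t x)
        + βs * [ fromℕ x - fromℕ x′ ]⁺
        + βg * [ fromℕ y - fromℕ y′ ]⁺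

    slotwise : ∀ {b} {B : Set b} → (ℕ → B) → List B
    slotwise f = applyUpTo (λ i → f (suc i)) T

    M : ℕ
    M = max 0 (slotwise λ t → ⌈ a t ⌉)

    objective : (x y : ℕ → ℕ) → Carrier
    objective x y = foldr _+_ 0#
      (slotwise λ t → stepCost (x (ℕ.pred t) , y (ℕ.pred t)) (x t , y t) t)

    record Feasible (x y : ℕ → ℕ) : Set ℓ₂ where
      field
        x₀≡0 : x 0 ≡ 0
        y₀≡0 : y 0 ≡ 0
        x≥a  : ∀ t → Slot t → a t ≤ fromℕ (x t)
        y≤N  : ∀ t → Slot t → y t ℕ.≤ N

    record Optimal (x y : ℕ → ℕ) : Set ℓ₂ where
      field
        feasible : Feasible x y
        minimal  : ∀ x′ y′ → Feasible x′ y′ → objective x y ≤ objective x′ y′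

    open ShortestPath F _≟ⱽ_

    -- Adds ⟨ x , y′ , t ⟩ for all y′ ≤ y.
    addColumn : (t x y : ℕ) → List Vertex → Timed (List Vertex)
    addColumn t x zero    acc = tick (return (⟨ x , 0 , t ⟩ ∷ acc))
    addColumn t x (suc y) acc = tick (addColumn t x y (⟨ x , suc y , t ⟩ ∷ acc))

    addIfAdequate : (t x : ℕ) → List Vertex → Timed (List Vertex)
    addIfAdequate t x acc = tick (
      if does (a t ≤? fromℕ x) then addColumn t x N acc else return acc)

    addColumns : (t x : ℕ) → List Vertex → Timed (List Vertex)
    addColumns t zero    acc = tick (addIfAdequate t 0 acc)
    addColumns t (suc x) acc = tick do
      acc′ ← addIfAdequate t (suc x) acc
      addColumns t x acc′

    layer : ℕ → Timed (List Vertex)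
    layer t = tick (
      if t ℕ.≡ᵇ 0 then return (⟨ 0 , 0 , 0 ⟩ ∷ [])
      else if t ℕ.≡ᵇ suc T then return (⟨ 0 , 0 , suc T ⟩ ∷ [])
      else addColumns t M [])

    edgeWeight : Vertex → Vertex → Carrier
    edgeWeight ⟨ x′ , y′ , _ ⟩ ⟨ x , y , t ⟩ =
      if t ℕ.≡ᵇ suc T then 0# else stepCost (x′ , y′) (x , y) t

    addStar : Vertex → List Vertex → List Edge → Timed (List Edge)
    addStar u []       acc = tick (return acc)
    addStar u (w ∷ ws) acc = tick (addStar u ws (edge u w (edgeWeight u w) ∷ acc))

    addJoin : List Vertex → List Vertex → List Edge → Timed (List Edge)
    addJoin []       ws acc = tick (return acc)
    addJoin (u ∷ us) ws acc = tick do
      acc′ ← addStar u ws acc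
      addJoin us ws acc′

    addLayer : ℕ → List Edge → Timed (List Edge)
    addLayer t acc = tick do
      us ← layer t
      ws ← layer (suc t)
      addJoin us ws acc

    addLayers : ℕ → List Edge → Timed (List Edge)
    addLayers zero    acc = tick (addLayer 0 acc)
    addLayers (suc t) acc = tick do
      acc′ ← addLayer (suc t) acc
      addLayers t acc′

    graph : Timed (List Edge)
    graph = addLayers T []

    states : List Vertex → Timed (List State)
    states []                   = tick (return [])
    states (⟨ x , y , _ ⟩ ∷ vs) = tick do
      ss ← states vs
      return ((x , y) ∷ ss)

    -- The states along a path without its two end vertices.
    interior : Maybe (List Vertex) → Timed (Maybe (List State))
    interior nothing         = tick (return nothing)
    interior (just [])       = tick (return nothing)
    interior (just (_ ∷ vs)) = tick do
      inner ← dropLast vs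
      ss    ← states inner
      return (just ss)

    algorithm : Timed (Maybe (List State))
    algorithm = tick do
      es   ← graph
      path ← dijkstra (suc M ℕ.* suc N ℕ.* (2 ℕ.+ T)) es ⟨ 0 , 0 , 0 ⟩ ⟨ 0 , 0 , suc T ⟩
      interior path

  -- The t-th state of a sequence numbered from 1, preceded by (0 , 0) at time 0.
  stateAt : List State → ℕ → State
  stateAt ss             zero          = 0 , 0
  stateAt []             (suc t)       = 0 , 0
  stateAt (s ∷ ss)       (suc zero)    = s
  stateAt (s ∷ ss)       (suc (suc t)) = stateAt ss (suc t)

  serversAt generatorsAt : List State → ℕ → ℕ
  serversAt    ss t = proj₁ (stateAt ss t)
  generatorsAt ss t = proj₂ (stateAt ss t)

{-# OPTIONS --safe #-}

-- A schedule using at most M servers is a path through the layered graph whose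
-- weight is its cost, and truncating a schedule at M servers does not increase
-- its cost, because ψ is monotone in the demand and the demand in the number of
-- servers.  So a lightest path is an optimal schedule.
--
-- For Dijkstra's algorithm with lazy deletion one maintains that every edge out
-- of a settled vertex leads to a vertex that is settled or queued at no greater
-- weight than via this edge; along any path to the goal one then meets a queue
-- entry that is not heavier than the path.  The size of the queue plus the number
-- of edges with unsettled source drops at each extraction, so the bound on the
-- extractions suffices and each edge is inserted at most once.  A leftist heap of
-- n entries has rank O(log n), hence E edges cost O(E log E), and
-- E ≤ (T + 1) ((M + 1) (N + 1))² = O(M² N² T).

module Submission where

open import Defs
open import Data.Bool.Base using (Bool; true; false; if_then_else_)
import Data.Bool.Properties as Bool
open import Data.List.Base
  using (List; []; _∷_; _++_; _∷ʳ_; _ʳ++_; length; map; filter; reverse; foldr; applyUpTo)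
open import Data.List.Extrema.Nat using (xs≤max)
open import Data.List.Membership.Propositional using (_∈_)
open import Data.List.Membership.Propositional.Properties
  using (∈-map⁺; ∈-map⁻; ∈-filter⁺; ∈-filter⁻)
import Data.List.Properties as List
open import Data.List.Relation.Binary.Permutation.Propositional
  using (_↭_; prep; ↭-refl; ↭-sym; ↭-trans; ↭-reflexive; module PermutationReasoning)
open import Data.List.Relation.Binary.Permutation.Propositional.Properties as Perm
  using (All-resp-↭; Any-resp-↭; ∈-resp-↭; ↭-length)
open import Data.List.Relation.Unary.All as All using (All; []; _∷_)
import Data.List.Relation.Unary.All.Properties as All
open import Data.List.Relation.Unary.Any as Any using (Any; here; there)
import Data.List.Relation.Unary.Any.Properties as Any
open import Data.Maybe.Base using (Maybe; just)
open import Data.Nat.Base as ℕ using (ℕ; zero; suc; _⊓_)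
open import Data.Nat.Logarithm using (⌊log₂_⌋; ⌊log₂⌋-mono-≤; ⌊log₂[2^n]⌋≡n)
import Data.Nat.Properties as ℕ
open import Data.Nat.Tactic.RingSolver using (solve-∀)
open import Data.Product.Base using (_×_; _,_; proj₁; proj₂; ∃-syntax)
open import Data.Sum.Base using (_⊎_; inj₁; inj₂)
open import Level using (_⊔_)
open import Relation.Binary.Bundles using (Poset)
open import Relation.Binary.Definitions using (DecidableEquality)
open import Relation.Binary.PropositionalEquality as ≡ using (_≡_; _≢_; refl)
open import Relation.Binary.Structures using (IsDecTotalOrder)
open import Relation.Nullary using (¬_; Dec; does; yes; no; contradiction)
open import Relation.Nullary.Decidable using (dec-true; dec-false)
import Algebra.Properties.Ring as RingProperties
import Relation.Binary.Reasoning.PartialOrder as PosetReasoning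

-- Shortest distances are never defined. The settled distances `D` live in the proof only, and
-- optimality is decided at a single moment: when the goal is extracted, every walk to it is bounded
-- below by some queue entry and hence by the root. Lazy deletion leaves stale duplicates in the
-- queue, and the count has to cover them. Fuel plus pending edges (those with unsettled source)
-- serves as a potential that pays a fixed amount `κ` for every extraction and every insertion.
-- Reversing the found path is outside this potential: its length enters the bound separately, until
-- the layering shows that a path to the goal has T + 2 vertices. Heaps and adjacency lists are
-- described up to permutation, since neither correctness nor cost depends on the order in which
-- they hold their elements.

if-elim : ∀ {a p q} {A : Set a} {B : Set p} {x y : A} (Q : A → Set q) (B? : Dec B) →
  (B → Q x) → (¬ B → Q y) → Q (if does B? then x else y)
if-elim Q (yes b) qx qy = qx b
if-elim Q (no ¬b) qx qy = qy ¬b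

-- Values and step counts of the list programs

reverseOnto-ʳ++ : ∀ {a} {A : Set a} (acc xs : List A) → value (reverseOnto acc xs) ≡ xs ʳ++ acc
reverseOnto-ʳ++ acc []       = refl
reverseOnto-ʳ++ acc (x ∷ xs) = reverseOnto-ʳ++ (x ∷ acc) xs

steps-reverseOnto : ∀ {a} {A : Set a} (acc xs : List A) →
  steps (reverseOnto acc xs) ≡ suc (length xs)
steps-reverseOnto acc []       = refl
steps-reverseOnto acc (x ∷ xs) = ≡.cong suc (steps-reverseOnto (x ∷ acc) xs)

value-lengthᵗ : ∀ {a} {A : Set a} (xs : List A) → value (lengthᵗ xs) ≡ length xs
value-lengthᵗ []       = refl
value-lengthᵗ (x ∷ xs) = ≡.cong suc (value-lengthᵗ xs)

steps-lengthᵗ : ∀ {a} {A : Set a} (xs : List A) → steps (lengthᵗ xs) ≡ suc (length xs)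
steps-lengthᵗ []       = refl
steps-lengthᵗ (x ∷ xs) =
  ≡.cong suc (≡.trans (ℕ.+-identityʳ _) (steps-lengthᵗ xs))

value-dropLast : ∀ {a} {A : Set a} (xs : List A) x → value (dropLast (xs ∷ʳ x)) ≡ xs
value-dropLast []           x = refl
value-dropLast (_ ∷ [])     x = refl
value-dropLast (y ∷ z ∷ xs) x = ≡.cong (y ∷_) (value-dropLast (z ∷ xs) x)

steps-dropLast : ∀ {a} {A : Set a} (xs : List A) x → steps (dropLast (xs ∷ʳ x)) ≡ suc (length xs)
steps-dropLast []           x = refl
steps-dropLast (_ ∷ [])     x = refl
steps-dropLast (y ∷ z ∷ xs) x = ≡.cong suc (≡.trans (ℕ.+-identityʳ _) (steps-dropLast (z ∷ xs) x))

-- Ordered fields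

module OrderedFieldProperties {c ℓ₁ ℓ₂} (F : ArchimedeanOrderedField c ℓ₁ ℓ₂) where

  open ArchimedeanOrderedField F hiding (refl)
  open IsDecTotalOrder isDecTotalOrder public
    using (total; antisym; ≤-respˡ-≈; ≤-respʳ-≈; isPartialOrder)
    renaming (refl to ≤-refl; trans to ≤-trans; reflexive to ≤-reflexive)
  open RingProperties ring using (-‿distribˡ-*; -‿involutive)

  poset : Poset c ℓ₁ ℓ₂
  poset = record { isPartialOrder = isPartialOrder }

  module ≤-Reasoning = PosetReasoning poset
  open ≤-Reasoning

  +-mono-≤ : ∀ {u v x y} → u ≤ v → x ≤ y → u + x ≤ v + y
  +-mono-≤ {u} {v} {x} {y} u≤v x≤y = begin
    u + x  ≤⟨ +-monoˡ-≤ x u≤v ⟩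
    v + x  ≈⟨ +-comm v x ⟩
    x + v  ≤⟨ +-monoˡ-≤ v x≤y ⟩
    y + v  ≈⟨ +-comm y v ⟩
    v + y  ∎

  +-nonNegative : ∀ {x y} → 0# ≤ x → 0# ≤ y → 0# ≤ x + y
  +-nonNegative {x} {y} 0≤x 0≤y = begin
    0#       ≈⟨ +-identityˡ 0# ⟨
    0# + 0#  ≤⟨ +-mono-≤ 0≤x 0≤y ⟩
    x + y    ∎

  x≤x+y : ∀ x {y} → 0# ≤ y → x ≤ x + y
  x≤x+y x {y} 0≤y = begin
    x       ≈⟨ +-identityʳ x ⟨
    x + 0#  ≤⟨ +-mono-≤ ≤-refl 0≤y ⟩
    x + y   ∎

  x≤y⇒0≤y-x : ∀ {x y} → x ≤ y → 0# ≤ y - x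
  x≤y⇒0≤y-x {x} {y} x≤y = begin
    0#     ≈⟨ -‿inverseʳ x ⟨
    x - x  ≤⟨ +-monoˡ-≤ (- x) x≤y ⟩
    y - x  ∎

  -‿anti-≤ : ∀ {x y} → x ≤ y → - y ≤ - x
  -‿anti-≤ {x} {y} x≤y = begin
    - y              ≈⟨ +-identityˡ (- y) ⟨
    0# - y           ≈⟨ +-congʳ (-‿inverseʳ x) ⟨
    (x - x) - y      ≈⟨ +-congʳ (+-comm x (- x)) ⟩
    (- x + x) - y    ≈⟨ +-assoc (- x) x (- y) ⟩
    - x + (x - y)    ≤⟨ +-mono-≤ ≤-refl (+-monoˡ-≤ (- y) x≤y) ⟩
    - x + (y - y)    ≈⟨ +-congˡ (-‿inverseʳ y) ⟩
    - x + 0#         ≈⟨ +-identityʳ (- x) ⟩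
    - x              ∎

  *-monoˡ-≤ : ∀ {z x y} → 0# ≤ z → x ≤ y → z * x ≤ z * y
  *-monoˡ-≤ {z} {x} {y} 0≤z x≤y = begin
    z * x                  ≤⟨ x≤x+y (z * x) (*-nonNegative 0≤z (x≤y⇒0≤y-x x≤y)) ⟩
    z * x + z * (y - x)    ≈⟨ distribˡ z x (y - x) ⟨
    z * (x + (y - x))      ≈⟨ *-congˡ (+-comm x (y - x)) ⟩
    z * ((y - x) + x)      ≈⟨ *-congˡ (+-assoc y (- x) x) ⟩
    z * (y + (- x + x))    ≈⟨ *-congˡ (+-congˡ (-‿inverseˡ x)) ⟩
    z * (y + 0#)           ≈⟨ *-congˡ (+-identityʳ y) ⟩
    z * y                  ∎

  0≤1 : 0# ≤ 1#
  0≤1 with total 0# 1#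
  ... | inj₁ 0≤1 = 0≤1
  ... | inj₂ 1≤0 = begin
    0#              ≤⟨ *-nonNegative 0≤-1 0≤-1 ⟩
    - 1# * - 1#     ≈⟨ -‿distribˡ-* 1# (- 1#) ⟨
    - (1# * - 1#)   ≈⟨ -‿cong (*-identityˡ (- 1#)) ⟩
    - - 1#          ≈⟨ -‿involutive 1# ⟩
    1#              ∎
    where
    0≤-1 : 0# ≤ - 1#
    0≤-1 = ≤-respʳ-≈ (+-identityˡ (- 1#)) (x≤y⇒0≤y-x 1≤0)

  ≰⇒≥ : ∀ {x y} → ¬ x ≤ y → y ≤ x
  ≰⇒≥ {x} {y} x≰y with total x y
  ... | inj₁ x≤y = contradiction x≤y x≰y
  ... | inj₂ y≤x = y≤x

  ≮⇒≥ : ∀ {x y} → ¬ x < y → y ≤ x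
  ≮⇒≥ {x} {y} x≮y with total x y
  ... | inj₂ y≤x = y≤x
  ... | inj₁ x≤y with x ≟ y
  ...   | yes x≈y = ≤-reflexive (sym x≈y)
  ...   | no  x≉y = contradiction (x≤y , x≉y) x≮y

  0≤fromℕ : ∀ n → 0# ≤ fromℕ n
  0≤fromℕ zero    = ≤-refl
  0≤fromℕ (suc n) = +-nonNegative 0≤1 (0≤fromℕ n)

  fromℕ-mono : ∀ {m n} → m ℕ.≤ n → fromℕ m ≤ fromℕ n
  fromℕ-mono {n = n} ℕ.z≤n = 0≤fromℕ n
  fromℕ-mono (ℕ.s≤s m≤n)   = +-mono-≤ ≤-refl (fromℕ-mono m≤n)

  []⁺-nonNegative : ∀ z → 0# ≤ [ z ]⁺
  []⁺-nonNegative z with 0# ≤? z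
  ... | yes 0≤z = 0≤z
  ... | no  _   = ≤-refl

  []⁺-mono : ∀ {y z} → y ≤ z → [ y ]⁺ ≤ [ z ]⁺
  []⁺-mono {y} {z} y≤z with 0# ≤? y | 0# ≤? z
  ... | yes _   | yes _   = y≤z
  ... | yes 0≤y | no  0≰z = contradiction (≤-trans 0≤y y≤z) 0≰z
  ... | no  _   | yes 0≤z = 0≤z
  ... | no  _   | no  _   = ≤-refl

  []⁺-nonPositive : ∀ {z} → z ≤ 0# → [ z ]⁺ ≤ 0#
  []⁺-nonPositive {z} z≤0 with 0# ≤? z
  ... | yes _ = z≤0
  ... | no  _ = ≤-refl

  -- If `m ≤ x′`, the truncated sequence has already reached its cap and cannot increase. Otherwise
  -- `x′` is unaffected by truncation and only `x` shrinks.
  increase-truncated : ∀ m x x′ →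
    [ fromℕ (x ⊓ m) - fromℕ (x′ ⊓ m) ]⁺ ≤ [ fromℕ x - fromℕ x′ ]⁺
  increase-truncated m x x′ with ℕ.≤-total m x′
  ... | inj₁ m≤x′ = begin
    [ fromℕ (x ⊓ m) - fromℕ (x′ ⊓ m) ]⁺  ≤⟨ []⁺-nonPositive decrease ⟩
    0#                                    ≤⟨ []⁺-nonNegative _ ⟩
    [ fromℕ x - fromℕ x′ ]⁺               ∎
    where
    decrease : fromℕ (x ⊓ m) - fromℕ (x′ ⊓ m) ≤ 0#
    decrease = ≤-trans
      (+-monoˡ-≤ _ (fromℕ-mono (≡.subst (x ⊓ m ℕ.≤_) (≡.sym (ℕ.m≥n⇒m⊓n≡n m≤x′)) (ℕ.m⊓n≤n x m))))
      (≤-reflexive (-‿inverseʳ _))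
  ... | inj₂ x′≤m = []⁺-mono (+-mono-≤ (fromℕ-mono (ℕ.m⊓n≤m x m))
    (-‿anti-≤ (fromℕ-mono (ℕ.≤-reflexive (≡.sym (ℕ.m≤n⇒m⊓n≡m x′≤m))))))

  ≤fromℕ-leastBound : ∀ x n → x ≤ fromℕ n → x ≤ fromℕ (leastBound x n)
  ≤fromℕ-leastBound x zero    x≤n = x≤n
  ≤fromℕ-leastBound x (suc n) x≤n with x ≤? fromℕ n
  ... | yes x≤n′ = ≤fromℕ-leastBound x n x≤n′
  ... | no  _    = x≤n

  ≤fromℕ-⌈⌉ : ∀ x → x ≤ fromℕ ⌈ x ⌉
  ≤fromℕ-⌈⌉ x = ≤fromℕ-leastBound x (proj₁ (archimedean x)) (proj₂ (archimedean x))

-- Leftist heaps and Dijkstra's algorithm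

module ShortestPathProperties {c ℓ₁ ℓ₂} (F : ArchimedeanOrderedField c ℓ₁ ℓ₂)
                              {v} {V : Set v} (_≟ⱽ_ : DecidableEquality V) where

  open ArchimedeanOrderedField F hiding (refl)
  open OrderedFieldProperties F
  open Memory _≟ⱽ_
  open ShortestPath F _≟ⱽ_
  open Entry
  open Edge

  infix 4 _⊑_
  _⊑_ : Entry → Entry → Set ℓ₂
  e ⊑ e′ = dist e ≤ dist e′

  entries : Heap → List Entry
  entries empty          = []
  entries (node _ e l r) = e ∷ entries l ++ entries r

  ∣_∣ : Heap → ℕ
  ∣ h ∣ = length (entries h)

  -- Heap order together with the leftist condition. The index `suc (rank r)` forces the stored
  -- number to be the real length of the right spine, so `rank` can be trusted in the estimates.
  data Valid : Heap → Set (c ⊔ v ⊔ ℓ₂) where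
    empty : Valid empty
    node  : ∀ {e l r} → rank r ℕ.≤ rank l → All (e ⊑_) (entries l ++ entries r) →
            Valid l → Valid r → Valid (node (suc (rank r)) e l r)

  root-⊑ : ∀ {n e l r} → Valid (node n e l r) → All (e ⊑_) (entries (node n e l r))
  root-⊑ (node _ e⊑ _ _) = ≤-refl ∷ e⊑

  makeNode-↭ : ∀ e l r → entries (value (makeNode e l r)) ↭ e ∷ entries l ++ entries r
  makeNode-↭ e l r with rank r ℕ.≤ᵇ rank l
  ... | true  = ↭-refl
  ... | false = prep e (Perm.++-comm (entries r) (entries l))

  makeNode-valid : ∀ {e l r} → All (e ⊑_) (entries l ++ entries r) → Valid l → Valid r →
    Valid (value (makeNode e l r))
  -- The boolean test in `makeNode` is what `does` of this decision computes to.
  makeNode-valid {e} {l} {r} e⊑ vl vr = if-elim Valid (rank r ℕ.≤? rank l)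
    (λ r≤l → node r≤l e⊑ vl vr)
    (λ r≰l → node (ℕ.<⇒≤ (ℕ.≰⇒> r≰l)) (All-resp-↭ (Perm.++-comm (entries l) (entries r)) e⊑) vr vl)

  merge-↭ : ∀ h₁ h₂ → entries (value (merge h₁ h₂)) ↭ entries h₁ ++ entries h₂
  merge-↭ empty              h₂    = ↭-refl
  merge-↭ h₁@(node _ _ _ _)  empty = ↭-reflexive (≡.sym (List.++-identityʳ (entries h₁)))
  merge-↭ h₁@(node _ e₁ l₁ r₁) h₂@(node _ e₂ l₂ r₂)
    with dist e₁ ≤? dist e₂ | merge-↭ r₁ h₂ | merge-↭ h₁ r₂
  ... | yes _ | ih | _ = begin
    entries (value (makeNode e₁ l₁ m))                ↭⟨ makeNode-↭ e₁ l₁ m ⟩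
    e₁ ∷ entries l₁ ++ entries m                      ↭⟨ prep e₁ (Perm.++⁺ˡ (entries l₁) ih) ⟩
    e₁ ∷ entries l₁ ++ entries r₁ ++ entries h₂
      ≡⟨ ≡.cong (e₁ ∷_) (List.++-assoc (entries l₁) (entries r₁) (entries h₂)) ⟨
    e₁ ∷ (entries l₁ ++ entries r₁) ++ entries h₂     ∎
    where
    open PermutationReasoning
    m = value (merge r₁ h₂)
  ... | no _ | _ | ih = begin
    entries (value (makeNode e₂ l₂ m))                ↭⟨ makeNode-↭ e₂ l₂ m ⟩
    e₂ ∷ entries l₂ ++ entries m                      ↭⟨ prep e₂ (Perm.++⁺ˡ (entries l₂) ih) ⟩
    e₂ ∷ entries l₂ ++ entries h₁ ++ entries r₂
      ↭⟨ prep e₂ (Perm.shifts (entries l₂) (entries h₁)) ⟩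
    e₂ ∷ entries h₁ ++ entries l₂ ++ entries r₂
      ↭⟨ Perm.shift e₂ (entries h₁) (entries l₂ ++ entries r₂) ⟨
    entries h₁ ++ e₂ ∷ entries l₂ ++ entries r₂       ∎
    where
    open PermutationReasoning
    m = value (merge h₁ r₂)

  merge-valid : ∀ {h₁ h₂} → Valid h₁ → Valid h₂ → Valid (value (merge h₁ h₂))
  merge-valid empty v₂ = v₂
  merge-valid v₁@(node _ _ _ _) empty = v₁
  merge-valid {h₁@(node _ e₁ l₁ r₁)} {h₂@(node _ e₂ l₂ r₂)}
              v₁@(node r₁≤l₁ e₁⊑ vl₁ vr₁) v₂@(node r₂≤l₂ e₂⊑ vl₂ vr₂)
    with dist e₁ ≤? dist e₂ | merge-valid vr₁ v₂ | merge-valid v₁ vr₂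
  ... | yes e₁≤e₂ | ih | _ = makeNode-valid
    (All.++⁺ (All.++⁻ˡ (entries l₁) e₁⊑)
      (All-resp-↭ (↭-sym (merge-↭ r₁ h₂))
        (All.++⁺ (All.++⁻ʳ (entries l₁) e₁⊑) (All.map (≤-trans e₁≤e₂) (root-⊑ v₂)))))
    vl₁ ih
  ... | no e₁≰e₂ | _ | ih = makeNode-valid
    (All.++⁺ (All.++⁻ˡ (entries l₂) e₂⊑)
      (All-resp-↭ (↭-sym (merge-↭ h₁ r₂))
        (All.++⁺ (All.map (≤-trans (≰⇒≥ e₁≰e₂)) (root-⊑ v₁)) (All.++⁻ʳ (entries l₂) e₂⊑))))
    vl₂ ih

  -- Each round moves down one of the two right spines and costs two steps, one for `merge` and one
  -- for `makeNode`; the remaining step is the round that meets an empty heap.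
  steps-merge : ∀ {h₁ h₂} → Valid h₁ → Valid h₂ →
    steps (merge h₁ h₂) ℕ.≤ suc (2 ℕ.* (rank h₁ ℕ.+ rank h₂))
  steps-merge empty v₂ = ℕ.s≤s ℕ.z≤n
  steps-merge (node _ _ _ _) empty = ℕ.s≤s ℕ.z≤n
  steps-merge {h₁@(node _ e₁ l₁ r₁)} {h₂@(node _ e₂ l₂ r₂)}
              v₁@(node _ _ _ vr₁) v₂@(node _ _ _ vr₂)
    with dist e₁ ≤? dist e₂ | steps-merge vr₁ v₂ | steps-merge v₁ vr₂
  ... | yes _ | ih | _ = begin
    suc (steps (merge r₁ h₂) ℕ.+ 1)                    ≤⟨ ℕ.s≤s (ℕ.+-monoˡ-≤ 1 ih) ⟩
    suc (suc (2 ℕ.* (rank r₁ ℕ.+ rank h₂)) ℕ.+ 1)      ≡⟨ two (rank r₁) (rank h₂) ⟩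
    suc (2 ℕ.* (suc (rank r₁) ℕ.+ rank h₂))            ∎
    where
    open ℕ.≤-Reasoning
    two : ∀ m n → suc (suc (2 ℕ.* (m ℕ.+ n)) ℕ.+ 1) ≡ suc (2 ℕ.* (suc m ℕ.+ n))
    two = solve-∀
  ... | no _ | _ | ih = begin
    suc (steps (merge h₁ r₂) ℕ.+ 1)                    ≤⟨ ℕ.s≤s (ℕ.+-monoˡ-≤ 1 ih) ⟩
    suc (suc (2 ℕ.* (rank h₁ ℕ.+ rank r₂)) ℕ.+ 1)      ≡⟨ two (rank h₁) (rank r₂) ⟩
    suc (2 ℕ.* (rank h₁ ℕ.+ suc (rank r₂)))            ∎
    where
    open ℕ.≤-Reasoning
    two : ∀ m n → suc (suc (2 ℕ.* (m ℕ.+ n)) ℕ.+ 1) ≡ suc (2 ℕ.* (m ℕ.+ suc n))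
    two = solve-∀

  -- By the leftist condition the left child has at least the rank of the right one, so each unit of
  -- rank doubles `suc ∣ h ∣`.
  2^rank≤1+size : ∀ {h} → Valid h → 2 ℕ.^ rank h ℕ.≤ suc ∣ h ∣
  2^rank≤1+size empty = ℕ.≤-refl
  2^rank≤1+size (node {e} {l} {r} r≤l e⊑ vl vr) = begin
    2 ℕ.* 2 ℕ.^ rank r                        ≡⟨ ≡.cong (2 ℕ.^ rank r ℕ.+_) (ℕ.+-identityʳ _) ⟩
    2 ℕ.^ rank r ℕ.+ 2 ℕ.^ rank r
      ≤⟨ ℕ.+-mono-≤ (ℕ.≤-trans (ℕ.^-monoʳ-≤ 2 r≤l) (2^rank≤1+size vl)) (2^rank≤1+size vr) ⟩
    suc ∣ l ∣ ℕ.+ suc ∣ r ∣                   ≡⟨ ℕ.+-suc (suc ∣ l ∣) ∣ r ∣ ⟩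
    suc (suc (∣ l ∣ ℕ.+ ∣ r ∣))
      ≡⟨ ≡.cong (λ n → suc (suc n)) (List.length-++ (entries l)) ⟨
    suc (suc (length (entries l ++ entries r)))  ∎
    where open ℕ.≤-Reasoning

  rank≤log : ∀ {b h} → Valid h → ∣ h ∣ ℕ.≤ b → rank h ℕ.≤ ⌊log₂ suc b ⌋
  rank≤log {b} {h} vh h≤b = begin
    rank h                   ≡⟨ ⌊log₂[2^n]⌋≡n (rank h) ⟨
    ⌊log₂ (2 ℕ.^ rank h) ⌋   ≤⟨ ⌊log₂⌋-mono-≤ (ℕ.≤-trans (2^rank≤1+size vh) (ℕ.s≤s h≤b)) ⟩
    ⌊log₂ suc b ⌋            ∎
    where open ℕ.≤-Reasoning

  singleton-valid : ∀ e → Valid (node 1 e empty empty)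
  singleton-valid e = node ℕ.z≤n [] empty empty

  insert-↭ : ∀ e h → entries (value (insert e h)) ↭ e ∷ entries h
  insert-↭ e h = merge-↭ (node 1 e empty empty) h

  insert-valid : ∀ e {h} → Valid h → Valid (value (insert e h))
  insert-valid e = merge-valid (singleton-valid e)

  -- The new one-element heap has rank 1, which adds 2 to the two steps that do not depend on `h`.
  steps-insert : ∀ {b} e {h} → Valid h → ∣ h ∣ ℕ.≤ b →
    steps (insert e h) ℕ.≤ 4 ℕ.+ 2 ℕ.* ⌊log₂ suc b ⌋
  steps-insert {b} e {h} vh h≤b = begin
    suc (steps (merge (node 1 e empty empty) h))  ≤⟨ ℕ.s≤s (steps-merge (singleton-valid e) vh) ⟩
    2 ℕ.+ 2 ℕ.* suc (rank h)                      ≡⟨ ≡.cong (2 ℕ.+_) (ℕ.*-suc 2 (rank h)) ⟩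
    4 ℕ.+ 2 ℕ.* rank h
      ≤⟨ ℕ.+-monoʳ-≤ 4 (ℕ.*-monoʳ-≤ 2 (rank≤log vh h≤b)) ⟩
    4 ℕ.+ 2 ℕ.* ⌊log₂ suc b ⌋                     ∎
    where open ℕ.≤-Reasoning

  -- Relaxation and adjacency lists

  extend : Entry → V × Carrier → Entry
  extend e (u , w) = entry (dist e + w) u (vertex e ∷ trail e)

  relax-↭ : ∀ e out h → entries (value (relax e out h)) ↭ map (extend e) out ++ entries h
  relax-↭ e []        h = ↭-refl
  relax-↭ e (a ∷ out) h = ↭-trans (relax-↭ e out (value (insert (extend e a) h)))
    (↭-trans (Perm.++⁺ˡ (map (extend e) out) (insert-↭ (extend e a) h))
      (Perm.shift (extend e a) (map (extend e) out) (entries h)))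

  relax-valid : ∀ e out {h} → Valid h → Valid (value (relax e out h))
  relax-valid e []        vh = vh
  relax-valid e (a ∷ out) vh = relax-valid e out (insert-valid (extend e a) vh)

  -- The queue grows during relaxation, so the size bound must allow in advance for all of `out`.
  steps-relax : ∀ {b} e out {h} → Valid h → length out ℕ.+ ∣ h ∣ ℕ.≤ b →
    steps (relax e out h) ℕ.≤ suc (length out ℕ.* (5 ℕ.+ 2 ℕ.* ⌊log₂ suc b ⌋))
  steps-relax e [] vh _ = ℕ.≤-refl
  steps-relax {b} e (a ∷ out) {h} vh out+h≤b = ℕ.s≤s (begin
    steps (insert e′ h) ℕ.+ steps (relax e out h′)
      ≤⟨ ℕ.+-mono-≤ (steps-insert e′ vh (ℕ.m+n≤o⇒n≤o (suc (length out)) out+h≤b))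
                    (steps-relax e out (insert-valid e′ vh) out+h′≤b) ⟩
    4 ℕ.+ 2 ℕ.* ℓ ℕ.+ suc (length out ℕ.* (5 ℕ.+ 2 ℕ.* ℓ))
      ≡⟨ ℕ.+-suc (4 ℕ.+ 2 ℕ.* ℓ) _ ⟩
    5 ℕ.+ 2 ℕ.* ℓ ℕ.+ length out ℕ.* (5 ℕ.+ 2 ℕ.* ℓ)  ∎)
    where
    open ℕ.≤-Reasoning
    e′ = extend e a
    h′ = value (insert e′ h)
    ℓ = ⌊log₂ suc b ⌋
    out+h′≤b : length out ℕ.+ ∣ h′ ∣ ℕ.≤ b
    out+h′≤b = begin
      length out ℕ.+ ∣ h′ ∣        ≡⟨ ≡.cong (length out ℕ.+_) (↭-length (insert-↭ e′ h)) ⟩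
      length out ℕ.+ suc ∣ h ∣     ≡⟨ ℕ.+-suc (length out) ∣ h ∣ ⟩
      suc (length out) ℕ.+ ∣ h ∣   ≤⟨ out+h≤b ⟩
      b                            ∎

  arc : Edge → V × Carrier
  arc (edge _ t w) = t , w

  outgoing : V → List Edge → List Edge
  outgoing s = filter λ e → s ≟ⱽ source e

  -- Prepending reverses the order of the edges, hence a permutation and not an equality.
  addEdges-↭ : ∀ es adj s → value (addEdges es adj) s ↭ map arc (outgoing s es) ++ adj s
  addEdges-↭ []                adj s = ↭-refl
  addEdges-↭ (e@(edge s′ t w) ∷ es) adj s
    with addEdges-↭ es (value (write adj s′ ((t , w) ∷ adj s′))) s
  ... | ih with s ≟ⱽ s′
  ...   | yes refl = ↭-trans ih (Perm.shift (t , w) (map arc (outgoing s es)) (adj s))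
  ...   | no  _    = ih

  steps-addEdges : ∀ es adj → steps (addEdges es adj) ≡ suc (3 ℕ.* length es)
  steps-addEdges []                adj = refl
  steps-addEdges (edge s t w ∷ es) adj =
    ≡.trans (≡.cong (3 ℕ.+_) (steps-addEdges es (value (write adj s ((t , w) ∷ adj s)))))
            (≡.cong suc (≡.sym (ℕ.*-suc 3 (length es))))

  write-same : ∀ {a} {A : Set a} (arr : Array A) u x → value (write arr u x) u ≡ x
  write-same arr u x with u ≟ⱽ u
  ... | yes _   = refl
  ... | no  u≢u = contradiction refl u≢u

  -- Walks and the invariant of the search

  module _ (es : List Edge) (start goal : V) where

    -- Built at the far end, with the predecessors nearest first and the new weight added on the
    -- right, exactly as `extend` builds entries. A queue entry is therefore a walk with no
    -- reassociation of its weight.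
    data Walk : V → List V → Carrier → Set (c ⊔ v) where
      []   : Walk start [] 0#
      _▷_ : ∀ {u us d w x} → Walk u us d → edge u w x ∈ es → Walk w (u ∷ us) (d + x)

    -- The number of insertions that may still happen: an edge is inserted only when its source is
    -- settled.
    pending : Array Bool → ℕ
    pending s = length (filter (λ e → s (source e) Bool.≟ false) es)

    settle-pending : ∀ {s u} → s u ≡ false →
      pending (value (write s u true)) ℕ.+ length (outgoing u es) ≡ pending s
    settle-pending {s} {u} su = go es
      where
      s′ = value (write s u true)
      go : ∀ es → length (filter (λ e → s′ (source e) Bool.≟ false) es) ℕ.+ length (outgoing u es)
                ≡ length (filter (λ e → s (source e) Bool.≟ false) es)
      go []       = refl
      -- `write` compares `source e` with `u` and `outgoing` compares `u` with `source e`; both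
      -- decisions must be fixed for the three filters to reduce.
      go (e ∷ es) with source e ≟ⱽ u | u ≟ⱽ source e
      ... | yes e≡u  | no  u≢e  = contradiction (≡.sym e≡u) u≢e
      ... | no  e≢u  | yes u≡e  = contradiction (≡.sym u≡e) e≢u
      ... | yes refl | yes _ rewrite su = ≡.trans (ℕ.+-suc _ _) (≡.cong suc (go es))
      ... | no  _    | no  _ with s (source e)
      ...   | true  = go es
      ...   | false = ≡.cong suc (go es)

    -- D records the distances at which vertices have been settled, and q is the
    -- content of the queue.
    Reached : Array Bool → Array Carrier → List Entry → V → Carrier → Set (c ⊔ v ⊔ ℓ₂)
    Reached s D q u b = (s u ≡ true × D u ≤ b) ⊎ Any (λ e → vertex e ≡ u × dist e ≤ b) q

    -- `start-reached` and `edge-reached` are the base and the step of the induction along a walk in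
    -- `frontier`. `settled≤` is what makes stale entries harmless, and `goal-open` ensures that a
    -- walk to the goal cannot end among the settled vertices.
    record Invariant (s : Array Bool) (D : Array Carrier) (q : List Entry) :
                     Set (c ⊔ v ⊔ ℓ₂) where
      field
        walks       : All (λ e → Walk (vertex e) (trail e) (dist e)) q
        settled≤    : ∀ u → s u ≡ true → All (λ e → D u ≤ dist e) q
        goal-open   : s goal ≡ false
        start-reached : Reached s D q start 0#
        edge-reached  : ∀ {u w x} → edge u w x ∈ es → s u ≡ true → Reached s D q w (D u + x)

    open Invariant

    Reached-≤ : ∀ {s D q u b b′} → b ≤ b′ → Reached s D q u b → Reached s D q u b′
    Reached-≤ b≤b′ (inj₁ (su , Du≤b)) = inj₁ (su , ≤-trans Du≤b b≤b′)
    Reached-≤ b≤b′ (inj₂ any)         = inj₂ (Any.map (λ (e≡u , e≤b) → e≡u , ≤-trans e≤b b≤b′) any)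

    Invariant-resp-↭ : ∀ {s D q q′} → q ↭ q′ → Invariant s D q → Invariant s D q′
    Invariant-resp-↭ {s} {D} {q} {q′} q↭q′ inv = record
      { walks         = All-resp-↭ q↭q′ (walks inv)
      ; settled≤      = λ u su → All-resp-↭ q↭q′ (settled≤ inv u su)
      ; goal-open     = goal-open inv
      ; start-reached = move (start-reached inv)
      ; edge-reached  = λ e∈es su → move (edge-reached inv e∈es su)
      }
      where
      move : ∀ {u b} → Reached s D q u b → Reached s D q′ u b
      move (inj₁ settled) = inj₁ settled
      move (inj₂ any)     = inj₂ (Any-resp-↭ q↭q′ any)

    discard : ∀ {s D e q} → s (vertex e) ≡ true → Invariant s D (e ∷ q) → Invariant s D q
    discard {s} {D} {e} {q} se inv = record
      { walks         = All.tail (walks inv)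
      ; settled≤      = λ u su → All.tail (settled≤ inv u su)
      ; goal-open     = goal-open inv
      ; start-reached = drop (start-reached inv)
      ; edge-reached  = λ e∈es su → drop (edge-reached inv e∈es su)
      }
      where
      drop : ∀ {u b} → Reached s D (e ∷ q) u b → Reached s D q u b
      drop (inj₁ settled)             = inj₁ settled
      -- If the discarded entry was the witness, its settled vertex takes over, with a distance that
      -- is no greater by `settled≤`.
      drop (inj₂ (here (refl , e≤b))) = inj₁ (se , ≤-trans (All.head (settled≤ inv (vertex e) se)) e≤b)
      drop (inj₂ (there any))         = inj₂ any

    module _ (0≤weight : ∀ {e} → e ∈ es → 0# ≤ weight e) where

      settle-vertex : ∀ {s D e q out} → out ↭ map arc (outgoing (vertex e) es) →
        s (vertex e) ≡ false → vertex e ≢ goal → All (e ⊑_) q → Invariant s D (e ∷ q) →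
        Invariant (value (write s (vertex e) true)) (value (write D (vertex e) (dist e)))
                  (map (extend e) out ++ q)
      settle-vertex {s} {D} {e} {q} {out} out↭ se e≢goal e⊑q inv = record
        { walks         = All.++⁺ (All.map⁺ (All.tabulate λ a∈out → All.head (walks inv) ▷ ∈out⇒∈es a∈out))
                                  (All.tail (walks inv))
        ; settled≤      = settled≤′
        ; goal-open     = goal-open′
        ; start-reached = move (start-reached inv)
        ; edge-reached  = edge-reached′
        }
        where
        s′ = value (write s (vertex e) true)
        D′ = value (write D (vertex e) (dist e))
        q′ = map (extend e) out ++ q

        ∈out⇒∈es : ∀ {w x} → (w , x) ∈ out → edge (vertex e) w x ∈ es
        ∈out⇒∈es a∈out with ∈-map⁻ arc (∈-resp-↭ out↭ a∈out)
        ... | edge u w x , e′∈ , refl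
            with ∈-filter⁻ (λ e′ → vertex e ≟ⱽ source e′) {xs = es} e′∈
        ...   | e′∈es , refl = e′∈es

        ∈es⇒∈out : ∀ {w x} → edge (vertex e) w x ∈ es → (w , x) ∈ out
        ∈es⇒∈out e′∈es = ∈-resp-↭ (↭-sym out↭)
          (∈-map⁺ arc (∈-filter⁺ (λ e′ → vertex e ≟ⱽ source e′) e′∈es refl))

        move : ∀ {u b} → Reached s D (e ∷ q) u b → Reached s′ D′ q′ u b
        move {u} (inj₁ (su , Du≤b)) with u ≟ⱽ vertex e
        -- A vertex settled earlier differs from the one being settled now, so its recorded distance
        -- is not overwritten.
        ... | yes refl = contradiction (≡.trans (≡.sym su) se) λ ()
        ... | no  _    = inj₁ (su , Du≤b)
        move {b = b} (inj₂ (here (refl , e≤b))) =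
          inj₁ (write-same s _ true , ≡.subst (_≤ b) (≡.sym (write-same D (vertex e) (dist e))) e≤b)
        move (inj₂ (there any)) = inj₂ (Any.++⁺ʳ (map (extend e) out) any)

        -- The only use of nonnegative weights in this step: the newly queued entries extend `e` and
        -- so are not lighter than `e`.
        e⊑q′ : All (e ⊑_) q′
        e⊑q′ = All.++⁺
          (All.map⁺ (All.tabulate λ a∈out → x≤x+y (dist e) (0≤weight (∈out⇒∈es a∈out))))
          e⊑q

        settled≤′ : ∀ u → s′ u ≡ true → All (λ e′ → D′ u ≤ dist e′) q′
        settled≤′ u su with u ≟ⱽ vertex e
        ... | yes _ = e⊑q′
        -- The entry `e` was itself in the queue, so it lies between every earlier settled distance
        -- and the new queue.
        ... | no  _ = All.map (≤-trans (All.head (settled≤ inv u su))) e⊑q′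

        goal-open′ : s′ goal ≡ false
        goal-open′ with goal ≟ⱽ vertex e
        ... | yes goal≡e = contradiction (≡.sym goal≡e) e≢goal
        ... | no  _      = goal-open inv

        edge-reached′ : ∀ {u w x} → edge u w x ∈ es → s′ u ≡ true → Reached s′ D′ q′ w (D′ u + x)
        edge-reached′ {u} e′∈es su with u ≟ⱽ vertex e
        -- Edges out of the vertex just settled have been queued at exactly `D′ u + x`.
        ... | yes refl = inj₂ (Any.++⁺ˡ (Any.map⁺ (Any.map (λ { refl → refl , ≤-refl }) (∈es⇒∈out e′∈es))))
        ... | no  _    = move (edge-reached inv e′∈es su)

      -- Induction along the walk: as long as it stays among settled vertices their distances are at
      -- most its weight so far. Once it has met a queue entry that is not heavier, the remaining
      -- nonnegative edges keep this true.
      frontier : ∀ {s D q u us d} → Invariant s D q → Walk u us d →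
        (s u ≡ true × D u ≤ d) ⊎ Any (λ e → dist e ≤ d) q
      frontier {s} {D} {q} inv = go
        where
        forget : ∀ {u b} → Reached s D q u b → (s u ≡ true × D u ≤ b) ⊎ Any (λ e → dist e ≤ b) q
        forget (inj₁ settled) = inj₁ settled
        forget (inj₂ any)     = inj₂ (Any.map proj₂ any)
        go : ∀ {u us d} → Walk u us d → (s u ≡ true × D u ≤ d) ⊎ Any (λ e → dist e ≤ d) q
        go [] = forget (start-reached inv)
        go (walk ▷ e∈es) with go walk
        ... | inj₁ (su , Du≤d) =
          forget (Reached-≤ {s} {D} (+-monoˡ-≤ _ Du≤d) (edge-reached inv e∈es su))
        ... | inj₂ any =
          inj₂ (Any.map (λ e≤d → ≤-trans e≤d (x≤x+y _ (0≤weight e∈es))) any)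

      goal-frontier : ∀ {s D q us d} → Invariant s D q → Walk goal us d → Any (λ e → dist e ≤ d) q
      goal-frontier inv walk with frontier inv walk
      ... | inj₁ (sgoal , _) = contradiction (≡.trans (≡.sym sgoal) (goal-open inv)) λ ()
      ... | inj₂ any         = any

      -- The summand `suc (length us)` pays for reversing the trail; no bound on its length is
      -- available for a general graph.
      record FindsShortest (m : Timed (Maybe (List V))) (b : ℕ) : Set (c ⊔ v ⊔ ℓ₂) where
        field
          {us}     : List V
          {optimum} : Carrier
          walk     : Walk goal us optimum
          found    : value m ≡ just (reverse (goal ∷ us))
          shortest : ∀ {us′ d} → Walk goal us′ d → optimum  ≤ d
          fast     : steps m ℕ.≤ b ℕ.+ suc (length us)

      open FindsShortest

      module _ (b : ℕ) (adj : Adjacency) (adj↭ : ∀ u → adj u ↭ map arc (outgoing u es))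
               (reachable : ∃[ us ] ∃[ d ] Walk goal us d) where

        -- The cost of one extraction, or of one insertion, for queues of size at most b.
        κ : ℕ
        κ = 8 ℕ.+ 4 ℕ.* ⌊log₂ suc b ⌋

        -- Two ranks of at most `⌊log₂ suc b ⌋` allow `merge` 1 + 4 `⌊log₂ suc b ⌋` steps, which
        -- leaves 7 of `κ`. The three branches of `settle` use 2, 3 and 5 of these.
        steps-mergeChildren : ∀ {n e l r} → Valid (node n e l r) → ∣ node n e l r ∣ ℕ.≤ b →
          steps (merge l r) ℕ.+ 7 ℕ.≤ κ
        steps-mergeChildren {n} {e} {l} {r} (node _ _ vl vr) h≤b = begin
          steps (merge l r) ℕ.+ 7               ≤⟨ ℕ.+-monoˡ-≤ 7 (steps-merge vl vr) ⟩
          suc (2 ℕ.* (rank l ℕ.+ rank r)) ℕ.+ 7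
            ≤⟨ ℕ.+-monoˡ-≤ 7 (ℕ.s≤s (ℕ.*-monoʳ-≤ 2 (ℕ.+-mono-≤ (rank≤log vl l≤b) (rank≤log vr r≤b)))) ⟩
          suc (2 ℕ.* (ℓ ℕ.+ ℓ)) ℕ.+ 7         ≡⟨ identity ℓ ⟩
          κ                                     ∎
          where
          open ℕ.≤-Reasoning
          ℓ = ⌊log₂ suc b ⌋
          identity : ∀ n → suc (2 ℕ.* (n ℕ.+ n)) ℕ.+ 7 ≡ 8 ℕ.+ 4 ℕ.* n
          identity = solve-∀
          l+r≤b : ∣ l ∣ ℕ.+ ∣ r ∣ ℕ.≤ b
          l+r≤b = ℕ.≤-trans (ℕ.n≤1+n _)
            (≡.subst (λ k → suc k ℕ.≤ b) (List.length-++ (entries l)) h≤b)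
          l≤b = ℕ.m+n≤o⇒m≤o ∣ l ∣ l+r≤b
          r≤b = ℕ.m+n≤o⇒n≤o ∣ l ∣ l+r≤b

        -- The fuel hypothesis reserves an extraction for every entry that is queued or may still
        -- come from a pending edge. With `n ≤ b` it also bounds every queue by `b`, so a single `κ`
        -- serves all rounds. In the cost, `n` pays for the extractions and `pending s` for the
        -- insertions.
        settle-correct : ∀ {n s D h} → Valid h → Invariant s D (entries h) →
          ∣ h ∣ ℕ.+ pending s ℕ.≤ n → n ℕ.≤ b →
          FindsShortest (settle n adj goal s h) ((n ℕ.+ pending s) ℕ.* κ)
        -- Since the goal is reachable, the queue cannot be empty. This also covers exhausted fuel,
        -- which forces an empty queue.
        settle-correct {h = empty} vh inv _ _ with goal-frontier inv (proj₂ (proj₂ reachable))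
        ... | ()
        settle-correct {suc n} {s} {D} {h@(node _ e l r)} vh@(node _ e⊑ vl vr) inv (ℕ.s≤s fuel) n<b
          with s (vertex e) in se
        ... | true = record
          { walk     = walk rec
          ; found    = found rec
          ; shortest = shortest rec
          ; fast     = begin
              suc (sm ℕ.+ suc sr)                     ≡⟨ arrange sm sr ⟩
              (sm ℕ.+ 2) ℕ.+ sr
                ≤⟨ ℕ.+-mono-≤ (ℕ.≤-trans (ℕ.+-monoʳ-≤ sm (ℕ.m≤m+n 2 5)) merge≤κ) (fast rec) ⟩
              κ ℕ.+ ((n ℕ.+ pending s) ℕ.* κ ℕ.+ suc (length (us rec)))  ≡⟨ ℕ.+-assoc κ _ _ ⟨
              κ ℕ.+ (n ℕ.+ pending s) ℕ.* κ ℕ.+ suc (length (us rec))    ∎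
          }
          where
          open ℕ.≤-Reasoning
          rest = value (merge l r)
          sm = steps (merge l r)
          merge≤κ = steps-mergeChildren vh (ℕ.≤-trans (ℕ.s≤s (ℕ.m+n≤o⇒m≤o _ fuel)) n<b)
          rec : FindsShortest (settle n adj goal s rest) ((n ℕ.+ pending s) ℕ.* κ)
          rec = settle-correct (merge-valid vl vr)
            (Invariant-resp-↭ (↭-sym (merge-↭ l r)) (discard se inv))
            (≡.subst (λ k → k ℕ.+ pending s ℕ.≤ n) (≡.sym (↭-length (merge-↭ l r))) fuel)
            (ℕ.<⇒≤ n<b)
          sr = steps (settle n adj goal s rest)
          arrange : ∀ k m → suc (k ℕ.+ suc m) ≡ (k ℕ.+ 2) ℕ.+ m
          arrange = solve-∀
        ... | false with vertex e ≟ⱽ goal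
        ...   | yes refl = record
          { walk     = All.head (walks inv)
          ; found    = ≡.cong just (reverseOnto-ʳ++ [] (vertex e ∷ trail e))
          -- The root is minimal in the queue, and every walk to the goal dominates some queue
          -- entry.
          ; shortest = λ walk′ → minimum (goal-frontier inv walk′)
          ; fast     = begin
              suc (sm ℕ.+ suc (sr ℕ.+ 0))
                ≡⟨ ≡.cong (λ k → suc (sm ℕ.+ suc (k ℕ.+ 0))) (steps-reverseOnto [] (vertex e ∷ trail e)) ⟩
              suc (sm ℕ.+ suc (suc len ℕ.+ 0))        ≡⟨ arrange sm len ⟩
              (sm ℕ.+ 3) ℕ.+ len
                ≤⟨ ℕ.+-monoˡ-≤ len (ℕ.≤-trans (ℕ.+-monoʳ-≤ sm (ℕ.m≤m+n 3 4)) merge≤κ) ⟩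
              κ ℕ.+ len                               ≤⟨ ℕ.+-monoˡ-≤ len (ℕ.m≤m+n κ _) ⟩
              κ ℕ.+ (n ℕ.+ pending s) ℕ.* κ ℕ.+ len   ∎
          }
          where
          open ℕ.≤-Reasoning
          sm = steps (merge l r)
          sr = steps (reverseOnto [] (vertex e ∷ trail e))
          len = suc (length (trail e))
          merge≤κ = steps-mergeChildren vh (ℕ.≤-trans (ℕ.s≤s (ℕ.m+n≤o⇒m≤o _ fuel)) n<b)
          arrange : ∀ k m → suc (k ℕ.+ suc (suc m ℕ.+ 0)) ≡ (k ℕ.+ 3) ℕ.+ m
          arrange = solve-∀
          minimum : ∀ {d} → Any (λ e′ → dist e′ ≤ d) (entries h) → dist e ≤ d
          minimum any = All.lookupWith (λ e⊑e′ e′≤d → ≤-trans e⊑e′ e′≤d) (root-⊑ vh) any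
        ...   | no e≢goal = record
          { walk     = walk rec
          ; found    = found rec
          ; shortest = shortest rec
          ; fast     = begin
              suc (sm ℕ.+ suc (suc (suc (sx ℕ.+ sr))))  ≡⟨ arrange sm sx sr ⟩
              (sm ℕ.+ 4) ℕ.+ sx ℕ.+ sr
                ≤⟨ ℕ.+-mono-≤ (ℕ.+-monoʳ-≤ (sm ℕ.+ 4) (steps-relax e (adj (vertex e)) (merge-valid vl vr) out+rest≤b)) (fast rec) ⟩
              (sm ℕ.+ 4) ℕ.+ suc (k ℕ.* (5 ℕ.+ 2 ℕ.* ℓ)) ℕ.+ ((n ℕ.+ p′) ℕ.* κ ℕ.+ len)
                                                        ≤⟨ ℕ.+-monoˡ-≤ _ relax≤ ⟩
              κ ℕ.+ k ℕ.* κ ℕ.+ ((n ℕ.+ p′) ℕ.* κ ℕ.+ len)  ≡⟨ collect κ k n p′ len ⟩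
              κ ℕ.+ (n ℕ.+ (p′ ℕ.+ k)) ℕ.* κ ℕ.+ len
                ≡⟨ ≡.cong (λ i → κ ℕ.+ (n ℕ.+ i) ℕ.* κ ℕ.+ len) p′+k≡p ⟩
              κ ℕ.+ (n ℕ.+ pending s) ℕ.* κ ℕ.+ len     ∎
          }
          where
          open ℕ.≤-Reasoning
          ℓ = ⌊log₂ suc b ⌋
          rest = value (merge l r)
          out = adj (vertex e)
          k = length out
          s′ = value (write s (vertex e) true)
          h′ = value (relax e out rest)
          p′ = pending s′
          sm = steps (merge l r)
          sx = steps (relax e out rest)
          merge≤κ = steps-mergeChildren vh (ℕ.≤-trans (ℕ.s≤s (ℕ.m+n≤o⇒m≤o _ fuel)) n<b)

          h′↭ : entries h′ ↭ map (extend e) out ++ entries l ++ entries r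
          h′↭ = ↭-trans (relax-↭ e out rest) (Perm.++⁺ˡ (map (extend e) out) (merge-↭ l r))

          p′+k≡p : p′ ℕ.+ k ≡ pending s
          p′+k≡p = ≡.trans
            (≡.cong (p′ ℕ.+_) (≡.trans (↭-length (adj↭ (vertex e))) (List.length-map arc (outgoing (vertex e) es))))
            (settle-pending se)

          -- The `k` insertions are balanced by the `k` edges that cease to be pending, and the
          -- extracted root by the unit of fuel just spent.
          fuel′ : ∣ h′ ∣ ℕ.+ p′ ℕ.≤ n
          fuel′ = begin
            ∣ h′ ∣ ℕ.+ p′                                      ≡⟨ ≡.cong (ℕ._+ p′) (↭-length h′↭) ⟩
            length (map (extend e) out ++ lr) ℕ.+ p′
              ≡⟨ ≡.cong (ℕ._+ p′) (List.length-++ (map (extend e) out)) ⟩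
            length (map (extend e) out) ℕ.+ length lr ℕ.+ p′
              ≡⟨ ≡.cong (λ i → i ℕ.+ length lr ℕ.+ p′) (List.length-map (extend e) out) ⟩
            k ℕ.+ length lr ℕ.+ p′                             ≡⟨ rotate k (length lr) p′ ⟩
            length lr ℕ.+ (p′ ℕ.+ k)                           ≡⟨ ≡.cong (length lr ℕ.+_) p′+k≡p ⟩
            length lr ℕ.+ pending s                            ≤⟨ fuel ⟩
            n                                                  ∎
            where
            lr = entries l ++ entries r
            rotate : ∀ i j k → i ℕ.+ j ℕ.+ k ≡ j ℕ.+ (k ℕ.+ i)
            rotate = solve-∀

          out+rest≤b : k ℕ.+ ∣ rest ∣ ℕ.≤ b
          out+rest≤b = begin
            k ℕ.+ ∣ rest ∣
              ≡⟨ ≡.cong (ℕ._+ ∣ rest ∣) (List.length-map (extend e) out) ⟨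
            length (map (extend e) out) ℕ.+ ∣ rest ∣  ≡⟨ List.length-++ (map (extend e) out) ⟨
            length (map (extend e) out ++ entries rest)  ≡⟨ ↭-length (relax-↭ e out rest) ⟨
            ∣ h′ ∣                                    ≤⟨ ℕ.m+n≤o⇒m≤o ∣ h′ ∣ fuel′ ⟩
            n                                         ≤⟨ ℕ.<⇒≤ n<b ⟩
            b                                         ∎

          rec : FindsShortest (settle n adj goal s′ h′) ((n ℕ.+ p′) ℕ.* κ)
          rec = settle-correct (relax-valid e out (merge-valid vl vr))
            (Invariant-resp-↭ (↭-sym h′↭) (settle-vertex (adj↭ (vertex e)) se e≢goal e⊑ inv))
            fuel′ (ℕ.<⇒≤ n<b)

          sr = steps (settle n adj goal s′ h′)
          len = suc (length (us rec))

          -- One `κ` covers the merge and the bookkeeping, and one more covers each insertion, as 5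
          -- + 2ℓ is at most 8 + 4ℓ.
          relax≤ : (sm ℕ.+ 4) ℕ.+ suc (k ℕ.* (5 ℕ.+ 2 ℕ.* ℓ)) ℕ.≤ κ ℕ.+ k ℕ.* κ
          relax≤ = begin
            (sm ℕ.+ 4) ℕ.+ suc (k ℕ.* (5 ℕ.+ 2 ℕ.* ℓ))  ≡⟨ shuffle sm (k ℕ.* (5 ℕ.+ 2 ℕ.* ℓ)) ⟩
            (sm ℕ.+ 5) ℕ.+ k ℕ.* (5 ℕ.+ 2 ℕ.* ℓ)
              ≤⟨ ℕ.+-mono-≤ (ℕ.≤-trans (ℕ.+-monoʳ-≤ sm (ℕ.m≤m+n 5 2)) merge≤κ)
                                                           (ℕ.*-monoʳ-≤ k (ℕ.+-mono-≤ (ℕ.m≤m+n 5 3) (ℕ.*-monoˡ-≤ ℓ (ℕ.m≤m+n 2 2)))) ⟩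
            κ ℕ.+ k ℕ.* κ                                ∎
            where
            shuffle : ∀ i j → (i ℕ.+ 4) ℕ.+ suc j ≡ (i ℕ.+ 5) ℕ.+ j
            shuffle = solve-∀

          arrange : ∀ i j m → suc (i ℕ.+ suc (suc (suc (j ℕ.+ m)))) ≡ (i ℕ.+ 4) ℕ.+ j ℕ.+ m
          arrange = solve-∀
          collect : ∀ κ k n p m → κ ℕ.+ k ℕ.* κ ℕ.+ ((n ℕ.+ p) ℕ.* κ ℕ.+ m) ≡ κ ℕ.+ (n ℕ.+ (p ℕ.+ k)) ℕ.* κ ℕ.+ m
          collect = solve-∀

      -- `2 * size` comes from the two arrays; `4 * length es` from filling the adjacency lists
      -- (three steps per edge) and counting the edges (one). The factor of `κ` adds the initial
      -- fuel `suc (length es)` to the `length es` edges pending at the start.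
      dijkstra-correct : ∀ size → ∃[ us ] ∃[ d ] Walk goal us d →
        FindsShortest (dijkstra size es start goal)
          (2 ℕ.* size ℕ.+ 4 ℕ.* length es ℕ.+ 5
            ℕ.+ (2 ℕ.* length es ℕ.+ 1) ℕ.* (8 ℕ.+ 4 ℕ.* ⌊log₂ (2 ℕ.+ length es) ⌋))
      dijkstra-correct size reachable = record
        { walk     = walk rec
        ; found    = found rec
        ; shortest = shortest rec
        ; fast     = begin
            suc (size ℕ.+ 0 ℕ.+ (sa ℕ.+ (size ℕ.+ 0 ℕ.+ (sl ℕ.+ suc (suc sr)))))
              ≡⟨ ≡.cong₂ (λ i j → suc (size ℕ.+ 0 ℕ.+ (i ℕ.+ (size ℕ.+ 0 ℕ.+ (j ℕ.+ suc (suc sr))))))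
                         (steps-addEdges es (λ _ → [])) (steps-lengthᵗ es) ⟩
            suc (size ℕ.+ 0 ℕ.+ (suc (3 ℕ.* m) ℕ.+ (size ℕ.+ 0 ℕ.+ (suc m ℕ.+ suc (suc sr)))))
              ≡⟨ arrange size m sr ⟩
            2 ℕ.* size ℕ.+ 4 ℕ.* m ℕ.+ 5 ℕ.+ sr
              ≤⟨ ℕ.+-monoʳ-≤ (2 ℕ.* size ℕ.+ 4 ℕ.* m ℕ.+ 5) (fast rec) ⟩
            2 ℕ.* size ℕ.+ 4 ℕ.* m ℕ.+ 5 ℕ.+ ((suc m ℕ.+ pending (λ _ → false)) ℕ.* κ₀ ℕ.+ len)
              ≡⟨ ≡.cong (λ i → 2 ℕ.* size ℕ.+ 4 ℕ.* m ℕ.+ 5 ℕ.+ ((suc m ℕ.+ i) ℕ.* κ₀ ℕ.+ len)) all-pending ⟩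
            2 ℕ.* size ℕ.+ 4 ℕ.* m ℕ.+ 5 ℕ.+ ((suc m ℕ.+ m) ℕ.* κ₀ ℕ.+ len)
              ≡⟨ collect size m κ₀ len ⟩
            2 ℕ.* size ℕ.+ 4 ℕ.* m ℕ.+ 5 ℕ.+ (2 ℕ.* m ℕ.+ 1) ℕ.* κ₀ ℕ.+ len  ∎
        }
        where
        open ℕ.≤-Reasoning hiding (start)
        m = length es
        adj = value (addEdges es λ _ → [])
        queue = node 1 (entry 0# start []) empty empty
        κ₀ = 8 ℕ.+ 4 ℕ.* ⌊log₂ (2 ℕ.+ m) ⌋

        adj↭ : ∀ u → adj u ↭ map arc (outgoing u es)
        adj↭ u = ↭-trans (addEdges-↭ es (λ _ → []) u) (↭-reflexive (List.++-identityʳ _))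

        all-pending : pending (λ _ → false) ≡ m
        all-pending = ≡.cong length (List.filter-all (λ _ → false Bool.≟ false) (All.universal (λ _ → refl) es))

        -- No vertex is settled yet, so the distances `0#` are mere placeholders.
        initial : Invariant (λ _ → false) (λ _ → 0#) (entries queue)
        initial = record
          { walks         = [] ∷ []
          ; settled≤      = λ _ ()
          ; goal-open     = refl
          ; start-reached = inj₂ (here (refl , ≤-refl))
          ; edge-reached  = λ _ ()
          }

        rec : FindsShortest (settle (suc (value (lengthᵗ es))) adj goal (λ _ → false) queue)
          ((suc m ℕ.+ pending (λ _ → false)) ℕ.* κ₀)
        rec = ≡.subst
          (λ n → FindsShortest (settle (suc n) adj goal (λ _ → false) queue)
                   ((suc m ℕ.+ pending (λ _ → false)) ℕ.* κ₀))
          (≡.sym (value-lengthᵗ es))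
          (settle-correct (suc m) adj adj↭ reachable (singleton-valid _) initial
            (ℕ.s≤s (ℕ.≤-reflexive all-pending)) ℕ.≤-refl)

        sa = steps (addEdges es λ _ → [])
        sl = steps (lengthᵗ es)
        sr = steps (settle (suc (value (lengthᵗ es))) adj goal (λ _ → false) queue)
        len = suc (length (us rec))

        arrange : ∀ z m r → suc (z ℕ.+ 0 ℕ.+ (suc (3 ℕ.* m) ℕ.+ (z ℕ.+ 0 ℕ.+ (suc m ℕ.+ suc (suc r)))))
          ≡ 2 ℕ.* z ℕ.+ 4 ℕ.* m ℕ.+ 5 ℕ.+ r
        arrange = solve-∀
        collect : ∀ z m k l → 2 ℕ.* z ℕ.+ 4 ℕ.* m ℕ.+ 5 ℕ.+ ((suc m ℕ.+ m) ℕ.* k ℕ.+ l)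
          ≡ 2 ℕ.* z ℕ.+ 4 ℕ.* m ℕ.+ 5 ℕ.+ (2 ℕ.* m ℕ.+ 1) ℕ.* k ℕ.+ l
        collect = solve-∀

-- The size of the layered graph

<1+log : ∀ n → n ℕ.< 2 ℕ.^ suc ⌊log₂ n ⌋
<1+log n = ℕ.≰⇒> λ 2^≤n → ℕ.1+n≰n
  (≡.subst (ℕ._≤ ⌊log₂ n ⌋) (⌊log₂[2^n]⌋≡n (suc ⌊log₂ n ⌋)) (⌊log₂⌋-mono-≤ 2^≤n))

-- Bounding `n` by 2^(ℓ+1) gives 6 + 2(ℓ+1) = 8 + 2ℓ, and ℓ ≥ 1 turns the 8 into 8ℓ.
log-64n² : ∀ {n} → 2 ℕ.≤ n → ⌊log₂ (64 ℕ.* (n ℕ.* n)) ⌋ ℕ.≤ 10 ℕ.* ⌊log₂ n ⌋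
log-64n² {n} 2≤n = begin
  ⌊log₂ (64 ℕ.* (n ℕ.* n)) ⌋
    ≤⟨ ⌊log₂⌋-mono-≤ (ℕ.*-monoʳ-≤ 64 (ℕ.*-mono-≤ n≤ n≤)) ⟩
  ⌊log₂ (2 ℕ.^ 6 ℕ.* (2 ℕ.^ suc ℓ ℕ.* 2 ℕ.^ suc ℓ)) ⌋
    ≡⟨ ≡.cong (λ k → ⌊log₂ (2 ℕ.^ 6 ℕ.* k) ⌋) (ℕ.^-distribˡ-+-* 2 (suc ℓ) (suc ℓ)) ⟨
  ⌊log₂ (2 ℕ.^ 6 ℕ.* 2 ℕ.^ (suc ℓ ℕ.+ suc ℓ)) ⌋
    ≡⟨ ≡.cong ⌊log₂_⌋ (ℕ.^-distribˡ-+-* 2 6 (suc ℓ ℕ.+ suc ℓ)) ⟨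
  ⌊log₂ (2 ℕ.^ (6 ℕ.+ (suc ℓ ℕ.+ suc ℓ))) ⌋
    ≡⟨ ⌊log₂[2^n]⌋≡n (6 ℕ.+ (suc ℓ ℕ.+ suc ℓ)) ⟩
  6 ℕ.+ (suc ℓ ℕ.+ suc ℓ)                                 ≡⟨ arrange ℓ ⟩
  8 ℕ.* 1 ℕ.+ 2 ℕ.* ℓ
    ≤⟨ ℕ.+-monoˡ-≤ (2 ℕ.* ℓ) (ℕ.*-monoʳ-≤ 8 1≤ℓ) ⟩
  8 ℕ.* ℓ ℕ.+ 2 ℕ.* ℓ                                     ≡⟨ ℕ.*-distribʳ-+ ℓ 8 2 ⟨
  10 ℕ.* ℓ                                                ∎
  where
  open ℕ.≤-Reasoning
  ℓ = ⌊log₂ n ⌋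
  n≤ = ℕ.<⇒≤ (<1+log n)
  1≤ℓ : 1 ℕ.≤ ℓ
  1≤ℓ = ⌊log₂⌋-mono-≤ 2≤n
  arrange : ∀ i → 6 ℕ.+ (suc i ℕ.+ suc i) ≡ 8 ℕ.* 1 ℕ.+ 2 ℕ.* i
  arrange = solve-∀

-- There are T + 1 pairs of consecutive layers, each layer with at most (M + 1)(N + 1) vertices.
edgeBound : ∀ M N T → ℕ
edgeBound M N T = suc T ℕ.* ((suc M ℕ.* suc N) ℕ.* (suc M ℕ.* suc N))

-- The hypothesis makes M, N and T positive, so k + 1 ≤ 2k for each of the five factors (T once, M
-- and N twice): 32 is 2 to the fifth.
edgeBound≤ : ∀ {M N T} → 2 ℕ.≤ M ℕ.* N ℕ.* T →
  edgeBound M N T ℕ.≤ 32 ℕ.* (M ℕ.^ 2 ℕ.* N ℕ.^ 2 ℕ.* T)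
edgeBound≤ {suc m} {suc n} {suc t} _ = begin
  suc T ℕ.* ((suc M ℕ.* suc N) ℕ.* (suc M ℕ.* suc N))
    ≤⟨ ℕ.*-mono-≤ (double t) (ℕ.*-mono-≤ (ℕ.*-mono-≤ (double m) (double n)) (ℕ.*-mono-≤ (double m) (double n))) ⟩
  2 ℕ.* T ℕ.* ((2 ℕ.* M ℕ.* (2 ℕ.* N)) ℕ.* (2 ℕ.* M ℕ.* (2 ℕ.* N)))
    ≡⟨ arrange M N T ⟩
  32 ℕ.* (M ℕ.^ 2 ℕ.* N ℕ.^ 2 ℕ.* T)  ∎
  where
  open ℕ.≤-Reasoning
  M = suc m
  N = suc n
  T = suc t
  double : ∀ k → suc (suc k) ℕ.≤ 2 ℕ.* suc k
  double k = ℕ.s≤s (ℕ.≤-trans (ℕ.≤-reflexive (ℕ.+-comm 1 k)) (ℕ.+-monoʳ-≤ k (ℕ.s≤s ℕ.z≤n)))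
  arrange : ∀ M N T → 2 ℕ.* T ℕ.* ((2 ℕ.* M ℕ.* (2 ℕ.* N)) ℕ.* (2 ℕ.* M ℕ.* (2 ℕ.* N)))
    ≡ 32 ℕ.* (M ℕ.* (M ℕ.* 1) ℕ.* (N ℕ.* (N ℕ.* 1)) ℕ.* T)
  arrange = solve-∀
edgeBound≤ {zero} ()
edgeBound≤ {suc m} {zero} {t} 2≤0 rewrite ℕ.*-zeroʳ m = contradiction 2≤0 λ ()
edgeBound≤ {suc m} {suc n} {zero} 2≤0 rewrite ℕ.*-zeroʳ (suc m ℕ.* suc n) = contradiction 2≤0 λ ()

-- The constant is 32 · (57 + 12) · 10: 32 from `edgeBound≤`, and 10 from `log-64n²`, used also to
-- absorb the constant 57 into the logarithm.
steps-bound : ∀ {M N T} → 2 ℕ.≤ M ℕ.* N ℕ.* T →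
  edgeBound M N T ℕ.* (57 ℕ.+ 12 ℕ.* ⌊log₂ (2 ℕ.+ edgeBound M N T) ⌋)
    ℕ.≤ 22080 ℕ.* (M ℕ.^ 2 ℕ.* N ℕ.^ 2 ℕ.* T ℕ.* ⌊log₂ (M ℕ.* N ℕ.* T) ⌋)
steps-bound {M} {N} {T} 2≤X = begin
  K ℕ.* (57 ℕ.+ 12 ℕ.* ⌊log₂ (2 ℕ.+ K) ⌋)
    ≤⟨ ℕ.*-monoˡ-≤ (57 ℕ.+ 12 ℕ.* ⌊log₂ (2 ℕ.+ K) ⌋) (edgeBound≤ {M} {N} {T} 2≤X) ⟩
  32 ℕ.* Q ℕ.* (57 ℕ.+ 12 ℕ.* ⌊log₂ (2 ℕ.+ K) ⌋)
    ≤⟨ ℕ.*-monoʳ-≤ (32 ℕ.* Q) (ℕ.+-mono-≤ (ℕ.*-monoʳ-≤ 57 1≤10ℓ) (ℕ.*-monoʳ-≤ 12 log≤)) ⟩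
  32 ℕ.* Q ℕ.* (57 ℕ.* (10 ℕ.* ℓ) ℕ.+ 12 ℕ.* (10 ℕ.* ℓ))  ≡⟨ arrange Q ℓ ⟩
  22080 ℕ.* (Q ℕ.* ℓ)                                     ∎
  where
  open ℕ.≤-Reasoning
  X = M ℕ.* N ℕ.* T
  Q = M ℕ.^ 2 ℕ.* N ℕ.^ 2 ℕ.* T
  K = edgeBound M N T
  ℓ = ⌊log₂ X ⌋

  Q≤X² : Q ℕ.≤ X ℕ.* X
  Q≤X² = begin
    Q                                                ≤⟨ ℕ.*-monoʳ-≤ (M ℕ.^ 2 ℕ.* N ℕ.^ 2) (square T) ⟩
    M ℕ.^ 2 ℕ.* N ℕ.^ 2 ℕ.* (T ℕ.* T)                ≡⟨ regroup M N T ⟩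
    X ℕ.* X                                          ∎
    where
    square : ∀ n → n ℕ.≤ n ℕ.* n
    square zero    = ℕ.z≤n
    square (suc n) = ℕ.m≤m*n (suc n) (suc n)
    regroup : ∀ M N T → M ℕ.* (M ℕ.* 1) ℕ.* (N ℕ.* (N ℕ.* 1)) ℕ.* (T ℕ.* T) ≡ M ℕ.* N ℕ.* T ℕ.* (M ℕ.* N ℕ.* T)
    regroup = solve-∀

  -- One half of 64 bounds `K`, the other absorbs the summand 2.
  2+K≤64X² : 2 ℕ.+ K ℕ.≤ 64 ℕ.* (X ℕ.* X)
  2+K≤64X² = begin
    2 ℕ.+ K
      ≤⟨ ℕ.+-mono-≤ (ℕ.*-mono-≤ {1} {32} (ℕ.s≤s ℕ.z≤n) (ℕ.*-mono-≤ 2≤X (ℕ.<⇒≤ 2≤X)))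
                                                (ℕ.≤-trans (edgeBound≤ {M} {N} {T} 2≤X) (ℕ.*-monoʳ-≤ 32 Q≤X²)) ⟩
    32 ℕ.* (X ℕ.* X) ℕ.+ 32 ℕ.* (X ℕ.* X)  ≡⟨ ℕ.*-distribʳ-+ (X ℕ.* X) 32 32 ⟨
    64 ℕ.* (X ℕ.* X)                       ∎

  log≤ : ⌊log₂ (2 ℕ.+ K) ⌋ ℕ.≤ 10 ℕ.* ℓ
  log≤ = ℕ.≤-trans (⌊log₂⌋-mono-≤ 2+K≤64X²) (log-64n² 2≤X)

  1≤10ℓ : 1 ℕ.≤ 10 ℕ.* ℓ
  1≤10ℓ = ℕ.≤-trans (⌊log₂⌋-mono-≤ {2} {X} 2≤X) (ℕ.m≤n*m ℓ 10)

  arrange : ∀ q l → 32 ℕ.* q ℕ.* (57 ℕ.* (10 ℕ.* l) ℕ.+ 12 ℕ.* (10 ℕ.* l)) ≡ 22080 ℕ.* (q ℕ.* l)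
  arrange = solve-∀

-- Schedules as paths in the layered graph

module DataCentreProperties {c ℓ₁ ℓ₂} (F : ArchimedeanOrderedField c ℓ₁ ℓ₂) where

  open ArchimedeanOrderedField F hiding (refl)
  open OrderedFieldProperties F
  open ShortestPath F _≟ⱽ_ using (Edge; edge; dijkstra)
  open ShortestPathProperties F _≟ⱽ_
  open DataCentre F

  sumUpTo : (ℕ → Carrier) → ℕ → Carrier
  sumUpTo f n = foldr _+_ 0# (applyUpTo f n)

  -- `objective` is summed by `foldr`, while a walk adds its newest edge on the right; this
  -- reassociation mediates between the two.
  sumUpTo-suc : ∀ f n → sumUpTo f (suc n) ≈ sumUpTo f n + f n
  sumUpTo-suc f zero    = +-comm (f 0) 0#
  sumUpTo-suc f (suc n) =
    trans (+-congˡ (sumUpTo-suc (λ i → f (suc i)) n)) (sym (+-assoc _ _ _))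

  sumUpTo-cong : ∀ {f h : ℕ → Carrier} n → (∀ {i} → i ℕ.< n → f i ≡ h i) → sumUpTo f n ≡ sumUpTo h n
  sumUpTo-cong zero    f≡h = refl
  sumUpTo-cong (suc n) f≡h = ≡.cong₂ _+_ (f≡h ℕ.z<s) (sumUpTo-cong n λ i<n → f≡h (ℕ.s<s i<n))

  stateAt-∷ʳ-≤ : ∀ ss {s t} → t ℕ.≤ length ss → stateAt (ss ∷ʳ s) t ≡ stateAt ss t
  stateAt-∷ʳ-≤ ss       {t = zero}        _           = refl
  stateAt-∷ʳ-≤ (_ ∷ ss) {t = suc zero}    _           = refl
  stateAt-∷ʳ-≤ (_ ∷ ss) {t = suc (suc t)} (ℕ.s≤s t<n) = stateAt-∷ʳ-≤ ss t<n

  stateAt-∷ʳ-last : ∀ ss s → stateAt (ss ∷ʳ s) (suc (length ss)) ≡ s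
  stateAt-∷ʳ-last []           s = refl
  stateAt-∷ʳ-last (_ ∷ [])     s = refl
  stateAt-∷ʳ-last (_ ∷ r ∷ ss) s = stateAt-∷ʳ-last (r ∷ ss) s

  stamp : ℕ → List State → List Vertex
  stamp t []             = []
  stamp t ((x , y) ∷ ss) = ⟨ x , y , suc t ⟩ ∷ stamp (suc t) ss

  stamp-∷ʳ : ∀ t ss x y → stamp t (ss ∷ʳ (x , y)) ≡ stamp t ss ∷ʳ ⟨ x , y , suc (t ℕ.+ length ss) ⟩
  stamp-∷ʳ t []       x y rewrite ℕ.+-identityʳ t = refl
  stamp-∷ʳ t (s ∷ ss) x y rewrite ℕ.+-suc t (length ss) = ≡.cong (_ ∷_) (stamp-∷ʳ (suc t) ss x y)

  length-stamp : ∀ t ss → length (stamp t ss) ≡ length ss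
  length-stamp t []       = refl
  length-stamp t (s ∷ ss) = ≡.cong suc (length-stamp (suc t) ss)

  module _ (P : DCM) where

    open DCM P

    -- Monotonicity and nonnegativity of the costs

    p≥0 : ∀ {t} → Slot t → 0# ≤ p t
    p≥0 slot = ≤-trans Pmin≥0 (p≥Pmin _ slot)

    d≥0 : ∀ {t} → Slot t → ∀ x → 0# ≤ d t x
    d≥0 slot x = g≥0 _ slot _ _ (0≤fromℕ x) (a≥0 _ slot)

    ψ-mono : ∀ y {price u w} → 0# ≤ price → u ≤ w → ψ y price u ≤ ψ y price w
    ψ-mono y {price} {u} {w} 0≤price u≤w with price ≤? cₒ
    ... | yes _ = +-mono-≤ ≤-refl (*-monoˡ-≤ 0≤price u≤w)
    ... | no  _ = if-elim (_≤ _) (L * Y <? u)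
      (λ Ly<u → if-elim (_ ≤_) (L * Y <? w)
        (λ _ → +-mono-≤ ≤-refl (*-monoˡ-≤ 0≤price (+-monoˡ-≤ _ u≤w)))
        -- A larger demand cannot fall back below the generator capacity.
        (λ Ly≮w → contradiction
          ( ≤-trans (proj₁ Ly<u) u≤w
          , λ Ly≈w → proj₂ Ly<u (antisym (proj₁ Ly<u) (≤-respʳ-≈ (sym Ly≈w) u≤w)))
          Ly≮w))
      (λ Ly≮u → if-elim (_ ≤_) (L * Y <? w)
        -- The demand crosses the capacity `L * Y`, where the two formulas agree; the comparison
        -- passes through that common value.
        (λ Ly<w → begin
          cₘ * Y + cₒ * u
            ≤⟨ +-mono-≤ ≤-refl (*-monoˡ-≤ cₒ≥0 (≮⇒≥ Ly≮u)) ⟩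
          cₘ * Y + cₒ * (L * Y)                         ≈⟨ +-congˡ (*-assoc cₒ L Y) ⟨
          cₘ * Y + cₒ * L * Y
            ≤⟨ x≤x+y _ (*-nonNegative 0≤price (x≤y⇒0≤y-x (proj₁ Ly<w))) ⟩
          cₘ * Y + cₒ * L * Y + price * (w - L * Y)     ∎)
        (λ _ → +-mono-≤ ≤-refl (*-monoˡ-≤ cₒ≥0 u≤w)))
      where
      open ≤-Reasoning
      Y = fromℕ y

    ψ-nonNegative : ∀ y {price u} → 0# ≤ price → 0# ≤ u → 0# ≤ ψ y price u
    ψ-nonNegative y {price} {u} 0≤price 0≤u with price ≤? cₒ
    ... | yes _ = +-nonNegative (*-nonNegative cₘ≥0 (0≤fromℕ y)) (*-nonNegative 0≤price 0≤u)
    ... | no  _ = if-elim (0# ≤_) (L * fromℕ y <? u)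
      (λ Ly<u → +-nonNegative
        (+-nonNegative (*-nonNegative cₘ≥0 (0≤fromℕ y))
          (*-nonNegative (*-nonNegative cₒ≥0 (proj₁ L>0)) (0≤fromℕ y)))
        (*-nonNegative 0≤price (x≤y⇒0≤y-x (proj₁ Ly<u))))
      (λ _ → +-nonNegative (*-nonNegative cₘ≥0 (0≤fromℕ y)) (*-nonNegative cₒ≥0 0≤u))

    stepCost-nonNegative : ∀ {t} → Slot t → ∀ s s′ → 0# ≤ stepCost s s′ t
    stepCost-nonNegative slot _ (x , y) = +-nonNegative
      (+-nonNegative (ψ-nonNegative y (p≥0 slot) (d≥0 slot x))
        (*-nonNegative (proj₁ βs>0) ([]⁺-nonNegative _)))
      (*-nonNegative (proj₁ βg>0) ([]⁺-nonNegative _))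

    -- Truncation lowers the demand, hence `ψ`, and does not enlarge any increase in servers; the
    -- generator term is untouched.
    stepCost-truncated : ∀ {t} → Slot t → ∀ x y x′ y′ →
      stepCost (x ⊓ M , y) (x′ ⊓ M , y′) t ≤ stepCost (x , y) (x′ , y′) t
    stepCost-truncated slot x y x′ y′ = +-monoˡ-≤ _ (+-mono-≤
      (ψ-mono y′ (p≥0 slot)
        (g-monotone₁ _ slot _ (a≥0 _ slot) _ _ (0≤fromℕ (x′ ⊓ M)) (fromℕ-mono (ℕ.m⊓n≤m x′ M))))
      (*-monoˡ-≤ (proj₁ βs>0) (increase-truncated M x′ x)))

    a≤M : ∀ {t} → Slot t → a t ≤ fromℕ M
    a≤M {suc t} (_ , t<T) = ≤-trans (≤fromℕ-⌈⌉ (a (suc t)))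
      (fromℕ-mono (All.applyUpTo⁻ (λ i → ⌈ a (suc i) ⌉) T (xs≤max 0 (slotwise λ t → ⌈ a t ⌉)) t<T))

    -- Vertices of the layered graph

    time : Vertex → ℕ
    time ⟨ _ , _ , t ⟩ = t

    -- A description of the vertices independent of the loops that enumerate them; `layer-sound` and
    -- `layer-complete` show that the two agree.
    data InLayer : Vertex → Set ℓ₂ where
      origin : InLayer ⟨ 0 , 0 , 0 ⟩
      slot   : ∀ {x y t} → Slot t → a t ≤ fromℕ x → x ℕ.≤ M → y ℕ.≤ N → InLayer ⟨ x , y , t ⟩
      final  : InLayer ⟨ 0 , 0 , suc T ⟩

    time≤1+T : ∀ {u} → InLayer u → time u ℕ.≤ suc T
    time≤1+T origin               = ℕ.z≤n
    time≤1+T (slot (_ , t≤T) _ _ _) = ℕ.m≤n⇒m≤1+n t≤T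
    time≤1+T final                = ℕ.≤-refl

    module _ {q} {Q : Vertex → Set q} where

      addColumn-All : ∀ {t x y acc} → (∀ {y′} → y′ ℕ.≤ y → Q ⟨ x , y′ , t ⟩) → All Q acc →
        All Q (value (addColumn t x y acc))
      addColumn-All {y = zero}  new old = new ℕ.z≤n ∷ old
      addColumn-All {y = suc y} new old =
        addColumn-All (λ y′≤y → new (ℕ.m≤n⇒m≤1+n y′≤y)) (new ℕ.≤-refl ∷ old)

      addIfAdequate-All : ∀ {t x acc} → (∀ {y} → a t ≤ fromℕ x → y ℕ.≤ N → Q ⟨ x , y , t ⟩) →
        All Q acc → All Q (value (addIfAdequate t x acc))
      addIfAdequate-All {t} {x} new old with a t ≤? fromℕ x
      ... | yes a≤x = addColumn-All (new a≤x) old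
      ... | no  _   = old

      addColumns-All : ∀ {t x acc} →
        (∀ {x′ y} → x′ ℕ.≤ x → a t ≤ fromℕ x′ → y ℕ.≤ N → Q ⟨ x′ , y , t ⟩) →
        All Q acc → All Q (value (addColumns t x acc))
      addColumns-All {x = zero}  new old = addIfAdequate-All (new ℕ.z≤n) old
      addColumns-All {x = suc x} new old =
        addColumns-All (λ x′≤x → new (ℕ.m≤n⇒m≤1+n x′≤x)) (addIfAdequate-All (new ℕ.≤-refl) old)

    addColumn-⊇ : ∀ {t x y acc u} → u ∈ acc → u ∈ value (addColumn t x y acc)
    addColumn-⊇ {y = zero}  u∈acc = there u∈acc
    addColumn-⊇ {y = suc y} u∈acc = addColumn-⊇ {y = y} (there u∈acc)

    addColumn-∋ : ∀ {t x y acc y′} → y′ ℕ.≤ y → ⟨ x , y′ , t ⟩ ∈ value (addColumn t x y acc)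
    addColumn-∋ {y = zero}  ℕ.z≤n = here refl
    addColumn-∋ {y = suc y} y′≤1+y with ℕ.m≤n⇒m<n∨m≡n y′≤1+y
    ... | inj₁ (ℕ.s≤s y′≤y) = addColumn-∋ {y = y} y′≤y
    ... | inj₂ refl         = addColumn-⊇ {y = y} (here refl)

    addIfAdequate-⊇ : ∀ {t x acc u} → u ∈ acc → u ∈ value (addIfAdequate t x acc)
    addIfAdequate-⊇ {t} {x} u∈acc with a t ≤? fromℕ x
    ... | yes _ = addColumn-⊇ {y = N} u∈acc
    ... | no  _ = u∈acc

    addIfAdequate-∋ : ∀ {t x acc y} → a t ≤ fromℕ x → y ℕ.≤ N →
      ⟨ x , y , t ⟩ ∈ value (addIfAdequate t x acc)
    addIfAdequate-∋ {t} {x} a≤x y≤N with a t ≤? fromℕ x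
    ... | yes _   = addColumn-∋ y≤N
    ... | no  a≰x = contradiction a≤x a≰x

    addColumns-⊇ : ∀ {t x acc u} → u ∈ acc → u ∈ value (addColumns t x acc)
    addColumns-⊇ {x = zero}  u∈acc = addIfAdequate-⊇ u∈acc
    addColumns-⊇ {x = suc x} u∈acc = addColumns-⊇ {x = x} (addIfAdequate-⊇ u∈acc)

    addColumns-∋ : ∀ {t x acc x′ y} → x′ ℕ.≤ x → a t ≤ fromℕ x′ → y ℕ.≤ N →
      ⟨ x′ , y , t ⟩ ∈ value (addColumns t x acc)
    addColumns-∋ {x = zero}  ℕ.z≤n   a≤x y≤N = addIfAdequate-∋ a≤x y≤N
    addColumns-∋ {x = suc x} x′≤1+x a≤x y≤N with ℕ.m≤n⇒m<n∨m≡n x′≤1+x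
    ... | inj₁ (ℕ.s≤s x′≤x) = addColumns-∋ {x = x} x′≤x a≤x y≤N
    ... | inj₂ refl         = addColumns-⊇ {x = x} (addIfAdequate-∋ a≤x y≤N)

    length-addColumn : ∀ t x y acc → length (value (addColumn t x y acc)) ≡ suc y ℕ.+ length acc
    length-addColumn t x zero    acc = refl
    length-addColumn t x (suc y) acc = ≡.trans (length-addColumn t x y _) (ℕ.+-suc (suc y) _)

    length-addIfAdequate : ∀ t x acc → length (value (addIfAdequate t x acc)) ℕ.≤ suc N ℕ.+ length acc
    length-addIfAdequate t x acc with a t ≤? fromℕ x
    ... | yes _ = ℕ.≤-reflexive (length-addColumn t x N acc)
    ... | no  _ = ℕ.m≤n+m _ (suc N)

    length-addColumns : ∀ t x acc →
      length (value (addColumns t x acc)) ℕ.≤ suc x ℕ.* suc N ℕ.+ length acc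
    length-addColumns t zero acc rewrite ℕ.+-identityʳ N = length-addIfAdequate t 0 acc
    length-addColumns t (suc x) acc = begin
      length (value (addColumns t x acc′))              ≤⟨ length-addColumns t x acc′ ⟩
      suc x ℕ.* suc N ℕ.+ length acc′
        ≤⟨ ℕ.+-monoʳ-≤ (suc x ℕ.* suc N) (length-addIfAdequate t (suc x) acc) ⟩
      suc x ℕ.* suc N ℕ.+ (suc N ℕ.+ length acc)
        ≡⟨ arrange (suc x ℕ.* suc N) (suc N) (length acc) ⟩
      suc N ℕ.+ suc x ℕ.* suc N ℕ.+ length acc          ∎
      where
      open ℕ.≤-Reasoning
      acc′ = value (addIfAdequate t (suc x) acc)
      arrange : ∀ i j k → i ℕ.+ (j ℕ.+ k) ≡ j ℕ.+ i ℕ.+ k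
      arrange = solve-∀

    steps-addColumn : ∀ t x y acc → steps (addColumn t x y acc) ≡ suc y
    steps-addColumn t x zero    acc = refl
    steps-addColumn t x (suc y) acc = ≡.cong suc (steps-addColumn t x y _)

    steps-addIfAdequate : ∀ t x acc → steps (addIfAdequate t x acc) ℕ.≤ 2 ℕ.+ N
    steps-addIfAdequate t x acc with a t ≤? fromℕ x
    ... | yes _ = ℕ.s≤s (ℕ.≤-reflexive (steps-addColumn t x N acc))
    ... | no  _ = ℕ.s≤s ℕ.z≤n

    steps-addColumns : ∀ t x acc → steps (addColumns t x acc) ℕ.≤ suc x ℕ.* (3 ℕ.+ N)
    steps-addColumns t zero acc rewrite ℕ.+-identityʳ N = ℕ.s≤s (steps-addIfAdequate t 0 acc)
    steps-addColumns t (suc x) acc = ℕ.s≤s (ℕ.+-mono-≤ (steps-addIfAdequate t (suc x) acc)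
      (steps-addColumns t x (value (addIfAdequate t (suc x) acc))))

    layer-slot : ∀ {t} → Slot t → layer t ≡ tick (addColumns t M [])
    -- The test `suc t ≡ᵇ suc T` and `does (t ≟ T)` both reduce to `t ≡ᵇ T`.
    layer-slot {suc t} (_ , t<T) rewrite dec-false (t ℕ.≟ T) (ℕ.<⇒≢ t<T) = refl

    layer-final : layer (suc T) ≡ tick (return (⟨ 0 , 0 , suc T ⟩ ∷ []))
    layer-final rewrite dec-true (T ℕ.≟ T) refl = refl

    -- Confines the boolean tests of `layer` to one place: properties of layers need checking only
    -- on its three possible results.
    layer-elim : ∀ {q} (Q : ℕ → Timed (List Vertex) → Set q) →
      Q 0 (tick (return (⟨ 0 , 0 , 0 ⟩ ∷ []))) →
      (∀ {t} → Slot t → Q t (tick (addColumns t M []))) →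
      Q (suc T) (tick (return (⟨ 0 , 0 , suc T ⟩ ∷ []))) →
      ∀ {t} → t ℕ.≤ suc T → Q t (layer t)
    layer-elim Q q₀ q q₁ {zero}  _     = q₀
    layer-elim Q q₀ q q₁ {suc t} t≤1+T with ℕ.m≤n⇒m<n∨m≡n t≤1+T
    ... | inj₁ (ℕ.s≤s t≤T) = ≡.subst (Q (suc t)) (≡.sym (layer-slot s)) (q s)
      where s = ℕ.s≤s ℕ.z≤n , t≤T
    ... | inj₂ refl = ≡.subst (Q (suc T)) (≡.sym layer-final) q₁

    layer-sound : ∀ {t} → t ℕ.≤ suc T → All (λ u → time u ≡ t × InLayer u) (value (layer t))
    layer-sound = layer-elim (λ t m → All (λ u → time u ≡ t × InLayer u) (value m))
      ((refl , origin) ∷ [])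
      (λ s → addColumns-All (λ x≤M a≤x y≤N → refl , slot s a≤x x≤M y≤N) [])
      ((refl , final) ∷ [])

    layer-complete : ∀ {u} → InLayer u → u ∈ value (layer (time u))
    layer-complete origin = here refl
    layer-complete {u} (slot s a≤x x≤M y≤N) =
      ≡.subst (λ m → u ∈ value m) (≡.sym (layer-slot s)) (addColumns-∋ x≤M a≤x y≤N)
    layer-complete {u} final = ≡.subst (λ m → u ∈ value m) (≡.sym layer-final) (here refl)

    S : ℕ
    S = suc M ℕ.* suc N

    length-layer : ∀ {t} → t ℕ.≤ suc T → length (value (layer t)) ℕ.≤ S
    length-layer = layer-elim (λ _ m → length (value m) ℕ.≤ S)
      (ℕ.s≤s ℕ.z≤n)
      (λ {t} _ → ℕ.≤-trans (length-addColumns t M []) (ℕ.≤-reflexive (ℕ.+-identityʳ S)))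
      (ℕ.s≤s ℕ.z≤n)

    steps-layer : ∀ {t} → t ℕ.≤ suc T → steps (layer t) ℕ.≤ 4 ℕ.* S
    steps-layer = layer-elim (λ _ m → steps m ℕ.≤ 4 ℕ.* S)
      (ℕ.s≤s ℕ.z≤n)
      (λ {t} _ → begin
        suc (steps (addColumns t M []))           ≤⟨ ℕ.s≤s (steps-addColumns t M []) ⟩
        1 ℕ.+ suc M ℕ.* (3 ℕ.+ N)                 ≤⟨ ℕ.+-mono-≤ {1} {S} (ℕ.s≤s ℕ.z≤n)
                                                       (ℕ.*-monoʳ-≤ (suc M) (ℕ.+-monoʳ-≤ 3 (ℕ.m≤m+n N _))) ⟩
        S ℕ.+ suc M ℕ.* (3 ℕ.+ 3 ℕ.* N)           ≡⟨ factor (suc M) N ⟩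
        4 ℕ.* S                                   ∎)
      (ℕ.s≤s ℕ.z≤n)
      where
      open ℕ.≤-Reasoning
      factor : ∀ m n → m ℕ.* suc n ℕ.+ m ℕ.* (3 ℕ.+ 3 ℕ.* n) ≡ 4 ℕ.* (m ℕ.* suc n)
      factor = solve-∀

    -- Edges of the layered graph

    module _ {q} {Q : Edge → Set q} where

      addStar-All : ∀ {u ws acc} → All (λ w → Q (edge u w (edgeWeight u w))) ws → All Q acc →
        All Q (value (addStar u ws acc))
      addStar-All []          old = old
      addStar-All (new ∷ rest) old = addStar-All rest (new ∷ old)

      addJoin-All : ∀ {us ws acc} → All (λ u → All (λ w → Q (edge u w (edgeWeight u w))) ws) us →
        All Q acc → All Q (value (addJoin us ws acc))
      addJoin-All []           old = old
      addJoin-All (new ∷ rest) old = addJoin-All rest (addStar-All new old)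

      addLayer-All : ∀ t {acc} →
        (∀ {u w} → u ∈ value (layer t) → w ∈ value (layer (suc t)) → Q (edge u w (edgeWeight u w))) →
        All Q acc → All Q (value (addLayer t acc))
      addLayer-All t new = addJoin-All (All.tabulate λ u∈ → All.tabulate (new u∈))

      addLayers-All : ∀ t {acc} →
        (∀ {k u w} → k ℕ.≤ t → u ∈ value (layer k) → w ∈ value (layer (suc k)) →
          Q (edge u w (edgeWeight u w))) →
        All Q acc → All Q (value (addLayers t acc))
      addLayers-All zero    new old = addLayer-All 0 (new ℕ.z≤n) old
      addLayers-All (suc t) new old =
        addLayers-All t (λ k≤t → new (ℕ.m≤n⇒m≤1+n k≤t)) (addLayer-All (suc t) (new ℕ.≤-refl) old)

    addStar-⊇ : ∀ {u e} ws {acc} → e ∈ acc → e ∈ value (addStar u ws acc)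
    addStar-⊇ []       e∈acc = e∈acc
    addStar-⊇ (w ∷ ws) e∈acc = addStar-⊇ ws (there e∈acc)

    addStar-∋ : ∀ {u w ws acc} → w ∈ ws → edge u w (edgeWeight u w) ∈ value (addStar u ws acc)
    addStar-∋ {ws = _ ∷ ws} (here refl) = addStar-⊇ ws (here refl)
    addStar-∋ (there w∈ws)              = addStar-∋ w∈ws

    addJoin-⊇ : ∀ us {ws e acc} → e ∈ acc → e ∈ value (addJoin us ws acc)
    addJoin-⊇ []                e∈acc = e∈acc
    addJoin-⊇ (u ∷ us) {ws = ws} e∈acc = addJoin-⊇ us (addStar-⊇ ws e∈acc)

    addJoin-∋ : ∀ {u w us ws acc} → u ∈ us → w ∈ ws →
      edge u w (edgeWeight u w) ∈ value (addJoin us ws acc)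
    addJoin-∋ {us = _ ∷ us} (here refl)  w∈ws = addJoin-⊇ us (addStar-∋ w∈ws)
    addJoin-∋               (there u∈us) w∈ws = addJoin-∋ u∈us w∈ws

    addLayers-⊇ : ∀ t {e acc} → e ∈ acc → e ∈ value (addLayers t acc)
    addLayers-⊇ zero    e∈acc = addJoin-⊇ (value (layer 0)) {ws = value (layer 1)} e∈acc
    addLayers-⊇ (suc t) e∈acc = addLayers-⊇ t (addJoin-⊇ (value (layer (suc t))) e∈acc)

    addLayers-∋ : ∀ t {k u w acc} → k ℕ.≤ t → u ∈ value (layer k) → w ∈ value (layer (suc k)) →
      edge u w (edgeWeight u w) ∈ value (addLayers t acc)
    addLayers-∋ zero    ℕ.z≤n u∈ w∈ = addJoin-∋ {ws = value (layer 1)} u∈ w∈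
    addLayers-∋ (suc t) k≤1+t u∈ w∈ with ℕ.m≤n⇒m<n∨m≡n k≤1+t
    ... | inj₁ (ℕ.s≤s k≤t) = addLayers-∋ t k≤t u∈ w∈
    ... | inj₂ refl        = addLayers-⊇ t (addJoin-∋ {ws = value (layer (suc (suc t)))} u∈ w∈)

    edges : List Edge
    edges = value graph

    Arc : Edge → Set (c ⊔ ℓ₂)
    Arc (edge u w x) = InLayer u × InLayer w × time w ≡ suc (time u) × x ≡ edgeWeight u w

    graph-sound : All Arc edges
    graph-sound = addLayers-All T arc-of []
      where
      arc-of : ∀ {k u w} → k ℕ.≤ T → u ∈ value (layer k) → w ∈ value (layer (suc k)) →
        Arc (edge u w (edgeWeight u w))
      arc-of k≤T u∈ w∈
        with All.lookup (layer-sound (ℕ.m≤n⇒m≤1+n k≤T)) u∈ | All.lookup (layer-sound (ℕ.s≤s k≤T)) w∈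
      ... | tu , u-in | tw , w-in = u-in , w-in , ≡.trans tw (≡.cong suc (≡.sym tu)) , refl

    graph-complete : ∀ {u w} → InLayer u → InLayer w → time w ≡ suc (time u) →
      edge u w (edgeWeight u w) ∈ edges
    graph-complete {u} {w} u-in w-in tw = addLayers-∋ T
      (ℕ.≤-pred (≡.subst (ℕ._≤ suc T) tw (time≤1+T w-in)))
      (layer-complete u-in)
      (≡.subst (λ t → w ∈ value (layer t)) tw (layer-complete w-in))

    edgeWeight-slot : ∀ x′ y′ t′ x y {t} → Slot t →
      edgeWeight ⟨ x′ , y′ , t′ ⟩ ⟨ x , y , t ⟩ ≡ stepCost (x′ , y′) (x , y) t
    edgeWeight-slot x′ y′ t′ x y {suc t} (_ , t<T) rewrite dec-false (t ℕ.≟ T) (ℕ.<⇒≢ t<T) = refl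

    edgeWeight-final : ∀ u → edgeWeight u ⟨ 0 , 0 , suc T ⟩ ≡ 0#
    edgeWeight-final _ rewrite dec-true (T ℕ.≟ T) refl = refl

    weight-nonNegative : ∀ {e} → e ∈ edges → 0# ≤ Edge.weight e
    weight-nonNegative {edge u@(⟨ x′ , y′ , t′ ⟩) (⟨ x , y , _ ⟩) _} e∈ with All.lookup graph-sound e∈
    -- No edge ends in `origin`, since its time 0 is not a successor.
    ... | _ , slot s _ _ _ , _ , refl = ≡.subst (0# ≤_) (≡.sym (edgeWeight-slot x′ y′ t′ x y s))
      (stepCost-nonNegative s (x′ , y′) (x , y))
    ... | _ , final , _ , refl        = ≡.subst (0# ≤_) (≡.sym (edgeWeight-final u)) ≤-refl

    length-addStar : ∀ u ws acc → length (value (addStar u ws acc)) ≡ length ws ℕ.+ length acc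
    length-addStar u []       acc = refl
    length-addStar u (w ∷ ws) acc = ≡.trans (length-addStar u ws _) (ℕ.+-suc (length ws) _)

    length-addJoin : ∀ us ws acc →
      length (value (addJoin us ws acc)) ≡ length us ℕ.* length ws ℕ.+ length acc
    length-addJoin []       ws acc = refl
    length-addJoin (u ∷ us) ws acc = begin
      length (value (addJoin us ws (value (addStar u ws acc))))        ≡⟨ length-addJoin us ws _ ⟩
      length us ℕ.* length ws ℕ.+ length (value (addStar u ws acc))
        ≡⟨ ≡.cong (length us ℕ.* length ws ℕ.+_) (length-addStar u ws acc) ⟩
      length us ℕ.* length ws ℕ.+ (length ws ℕ.+ length acc)
        ≡⟨ arrange (length us ℕ.* length ws) (length ws) (length acc) ⟩
      length ws ℕ.+ length us ℕ.* length ws ℕ.+ length acc             ∎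
      where
      open ≡.≡-Reasoning
      arrange : ∀ i j k → i ℕ.+ (j ℕ.+ k) ≡ j ℕ.+ i ℕ.+ k
      arrange = solve-∀

    steps-addStar : ∀ u ws acc → steps (addStar u ws acc) ≡ suc (length ws)
    steps-addStar u []       acc = refl
    steps-addStar u (w ∷ ws) acc = ≡.cong suc (steps-addStar u ws _)

    steps-addJoin : ∀ us ws acc → steps (addJoin us ws acc) ≡ suc (length us ℕ.* (2 ℕ.+ length ws))
    steps-addJoin []       ws acc = refl
    steps-addJoin (u ∷ us) ws acc = begin
      suc (steps (addStar u ws acc) ℕ.+ steps (addJoin us ws (value (addStar u ws acc))))
        ≡⟨ ≡.cong suc (≡.cong₂ ℕ._+_ (steps-addStar u ws acc) (steps-addJoin us ws _)) ⟩
      suc (suc (length ws) ℕ.+ suc (length us ℕ.* (2 ℕ.+ length ws)))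
        ≡⟨ ≡.cong (λ n → suc (suc n)) (ℕ.+-suc (length ws) _) ⟩
      suc (suc (suc (length ws)) ℕ.+ length us ℕ.* (2 ℕ.+ length ws))  ∎
      where open ≡.≡-Reasoning

    length-addLayer : ∀ {t} acc → t ℕ.≤ T → length (value (addLayer t acc)) ℕ.≤ S ℕ.* S ℕ.+ length acc
    length-addLayer {t} acc t≤T = ℕ.≤-trans
      (ℕ.≤-reflexive (length-addJoin (value (layer t)) (value (layer (suc t))) acc))
      (ℕ.+-monoˡ-≤ (length acc)
        (ℕ.*-mono-≤ (length-layer (ℕ.m≤n⇒m≤1+n t≤T)) (length-layer (ℕ.s≤s t≤T))))

    length-addLayers : ∀ {t} acc → t ℕ.≤ T →
      length (value (addLayers t acc)) ℕ.≤ suc t ℕ.* (S ℕ.* S) ℕ.+ length acc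
    length-addLayers {zero}  acc t≤T = ℕ.≤-trans (length-addLayer acc t≤T)
      (ℕ.+-monoˡ-≤ (length acc) (ℕ.m≤m+n (S ℕ.* S) 0))
    length-addLayers {suc t} acc t<T = begin
      length (value (addLayers t acc′))
        ≤⟨ length-addLayers acc′ (ℕ.<⇒≤ t<T) ⟩
      suc t ℕ.* (S ℕ.* S) ℕ.+ length acc′
        ≤⟨ ℕ.+-monoʳ-≤ (suc t ℕ.* (S ℕ.* S)) (length-addLayer acc t<T) ⟩
      suc t ℕ.* (S ℕ.* S) ℕ.+ (S ℕ.* S ℕ.+ length acc)
        ≡⟨ arrange (suc t ℕ.* (S ℕ.* S)) (S ℕ.* S) (length acc) ⟩
      S ℕ.* S ℕ.+ suc t ℕ.* (S ℕ.* S) ℕ.+ length acc            ∎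
      where
      open ℕ.≤-Reasoning
      acc′ = value (addLayer (suc t) acc)
      arrange : ∀ i j k → i ℕ.+ (j ℕ.+ k) ≡ j ℕ.+ i ℕ.+ k
      arrange = solve-∀

    length-edges : length edges ℕ.≤ suc T ℕ.* (S ℕ.* S)
    length-edges = ℕ.≤-trans (length-addLayers [] ℕ.≤-refl) (ℕ.≤-reflexive (ℕ.+-identityʳ _))

    S≥1 : 1 ℕ.≤ S
    S≥1 = ℕ.s≤s ℕ.z≤n

    -- Two layers and their join cost at most 2 + 10 S + S² steps; as S ≥ 1, the lower powers are
    -- absorbed into S².
    steps-addLayer : ∀ {t} acc → t ℕ.≤ T → steps (addLayer t acc) ℕ.≤ 13 ℕ.* (S ℕ.* S)
    steps-addLayer {t} acc t≤T = begin
      suc (steps (layer t) ℕ.+ (steps (layer (suc t)) ℕ.+ steps (addJoin us ws acc)))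
        ≤⟨ ℕ.s≤s (ℕ.+-mono-≤ (steps-layer t≤1+T) (ℕ.+-mono-≤ (steps-layer (ℕ.s≤s t≤T)) join≤)) ⟩
      suc (4 ℕ.* S ℕ.+ (4 ℕ.* S ℕ.+ suc (S ℕ.* (2 ℕ.+ S))))
        ≡⟨ arrange S ⟩
      2 ℕ.* (1 ℕ.* 1) ℕ.+ 10 ℕ.* (1 ℕ.* S) ℕ.+ S ℕ.* S
        ≤⟨ ℕ.+-monoˡ-≤ (S ℕ.* S) (ℕ.+-mono-≤ (ℕ.*-monoʳ-≤ 2 (ℕ.*-mono-≤ S≥1 S≥1)) (ℕ.*-monoʳ-≤ 10 (ℕ.*-monoˡ-≤ S S≥1))) ⟩
      2 ℕ.* (S ℕ.* S) ℕ.+ 10 ℕ.* (S ℕ.* S) ℕ.+ S ℕ.* S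
        ≡⟨ collect (S ℕ.* S) ⟩
      13 ℕ.* (S ℕ.* S)  ∎
      where
      open ℕ.≤-Reasoning
      us = value (layer t)
      ws = value (layer (suc t))
      t≤1+T = ℕ.m≤n⇒m≤1+n t≤T
      join≤ : steps (addJoin us ws acc) ℕ.≤ suc (S ℕ.* (2 ℕ.+ S))
      join≤ = ℕ.≤-trans (ℕ.≤-reflexive (steps-addJoin us ws acc))
        (ℕ.s≤s (ℕ.*-mono-≤ (length-layer t≤1+T) (ℕ.+-monoʳ-≤ 2 (length-layer (ℕ.s≤s t≤T)))))
      arrange : ∀ s → suc (4 ℕ.* s ℕ.+ (4 ℕ.* s ℕ.+ suc (s ℕ.* (2 ℕ.+ s))))
        ≡ 2 ℕ.* (1 ℕ.* 1) ℕ.+ 10 ℕ.* (1 ℕ.* s) ℕ.+ s ℕ.* s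
      arrange = solve-∀
      collect : ∀ r → 2 ℕ.* r ℕ.+ 10 ℕ.* r ℕ.+ r ≡ 13 ℕ.* r
      collect = solve-∀

    -- The step from 13 to 14 pays for the tick of each round, as 1 ≤ S².
    steps-addLayers : ∀ {t} acc → t ℕ.≤ T → steps (addLayers t acc) ℕ.≤ suc t ℕ.* (14 ℕ.* (S ℕ.* S))
    steps-addLayers {zero}  acc t≤T = ℕ.≤-trans
      (ℕ.+-mono-≤ (ℕ.*-mono-≤ S≥1 S≥1) (steps-addLayer acc t≤T)) (ℕ.m≤m+n _ 0)
    steps-addLayers {suc t} acc t<T = ℕ.≤-trans
      (ℕ.+-mono-≤ (ℕ.*-mono-≤ S≥1 S≥1)
        (ℕ.+-mono-≤ (steps-addLayer acc t<T) (steps-addLayers (value (addLayer (suc t) acc)) (ℕ.<⇒≤ t<T))))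
      (ℕ.≤-reflexive (≡.sym (ℕ.+-assoc (S ℕ.* S) _ _)))

    steps-graph : steps graph ℕ.≤ suc T ℕ.* (14 ℕ.* (S ℕ.* S))
    steps-graph = steps-addLayers [] ℕ.≤-refl

    -- From paths to schedules

    Path : Vertex → List Vertex → Carrier → Set c
    Path = Walk edges ⟨ 0 , 0 , 0 ⟩ ⟨ 0 , 0 , suc T ⟩

    -- Indexed from 0 so that `objective x y` is `sumUpTo (costs x y) T` by computation.
    costs : (x y : ℕ → ℕ) → ℕ → Carrier
    costs x y i = stepCost (x i , y i) (x (suc i) , y (suc i)) (suc i)

    -- The schedule read off a path. `vertices` identifies the reversed trail with the list from
    -- which `interior` extracts the states. For the cost only the upper bound is recorded, the
    -- direction in which the optimality of the output is deduced.
    record Trajectory (x y t : ℕ) (us : List Vertex) (d : Carrier) : Set (c ⊔ ℓ₂) where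
      field
        ss         : List State
        length-ss  : length ss ≡ t
        last-state : stateAt ss t ≡ (x , y)
        vertices   : reverse (⟨ x , y , t ⟩ ∷ us) ≡ ⟨ 0 , 0 , 0 ⟩ ∷ stamp 0 ss
        adequate   : ∀ k → 1 ℕ.≤ k → k ℕ.≤ t → a k ≤ fromℕ (serversAt ss k) × generatorsAt ss k ℕ.≤ N
        cost≤      : sumUpTo (costs (serversAt ss) (generatorsAt ss)) t ≤ d

    open Trajectory

    trajectory-∷ʳ : ∀ {x y t us d x′ y′} → Trajectory x y t us d →
      Slot (suc t) → a (suc t) ≤ fromℕ x′ → y′ ℕ.≤ N →
      Trajectory x′ y′ (suc t) (⟨ x , y , t ⟩ ∷ us) (d + stepCost (x , y) (x′ , y′) (suc t))
    trajectory-∷ʳ {x} {y} {t} {us} {d} {x′} {y′} τ s a≤x′ y′≤N = record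
      { ss         = ss′
      ; length-ss  = ≡.trans (List.length-++ (ss τ)) (≡.trans (ℕ.+-comm _ 1) (≡.cong suc (length-ss τ)))
      ; last-state = new
      ; vertices   = begin
          reverse (⟨ x′ , y′ , suc t ⟩ ∷ ⟨ x , y , t ⟩ ∷ us)
            ≡⟨ List.unfold-reverse _ (⟨ x , y , t ⟩ ∷ us) ⟩
          reverse (⟨ x , y , t ⟩ ∷ us) ∷ʳ ⟨ x′ , y′ , suc t ⟩
            ≡⟨ ≡.cong (_∷ʳ ⟨ x′ , y′ , suc t ⟩) (vertices τ) ⟩
          ⟨ 0 , 0 , 0 ⟩ ∷ stamp 0 (ss τ) ∷ʳ ⟨ x′ , y′ , suc t ⟩
            ≡⟨ ≡.cong (λ k → ⟨ 0 , 0 , 0 ⟩ ∷ stamp 0 (ss τ) ∷ʳ ⟨ x′ , y′ , suc k ⟩) (length-ss τ) ⟨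
          ⟨ 0 , 0 , 0 ⟩ ∷ stamp 0 (ss τ) ∷ʳ ⟨ x′ , y′ , suc (length (ss τ)) ⟩
            ≡⟨ ≡.cong (_ ∷_) (stamp-∷ʳ 0 (ss τ) x′ y′) ⟨
          ⟨ 0 , 0 , 0 ⟩ ∷ stamp 0 ss′                              ∎
      ; adequate   = adequate′
      ; cost≤      = sum≤
      }
      where
      open ≡.≡-Reasoning
      ss′ = ss τ ∷ʳ (x′ , y′)

      old : ∀ {k} → k ℕ.≤ t → stateAt ss′ k ≡ stateAt (ss τ) k
      old k≤t = stateAt-∷ʳ-≤ (ss τ) (≡.subst (_ ℕ.≤_) (≡.sym (length-ss τ)) k≤t)

      new : stateAt ss′ (suc t) ≡ (x′ , y′)
      new = ≡.subst (λ k → stateAt ss′ (suc k) ≡ (x′ , y′)) (length-ss τ) (stateAt-∷ʳ-last (ss τ) (x′ , y′))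

      adequate′ : ∀ k → 1 ℕ.≤ k → k ℕ.≤ suc t → a k ≤ fromℕ (serversAt ss′ k) × generatorsAt ss′ k ℕ.≤ N
      adequate′ k 1≤k k≤1+t with ℕ.m≤n⇒m<n∨m≡n k≤1+t
      ... | inj₁ (ℕ.s≤s k≤t) = ≡.subst (λ r → a k ≤ fromℕ (proj₁ r) × proj₂ r ℕ.≤ N) (≡.sym (old k≤t))
        (adequate τ k 1≤k k≤t)
      ... | inj₂ refl        = ≡.subst (λ r → a k ≤ fromℕ (proj₁ r) × proj₂ r ℕ.≤ N) (≡.sym new) (a≤x′ , y′≤N)

      cost : List State → ℕ → Carrier
      cost rs = costs (serversAt rs) (generatorsAt rs)

      -- Appending a state leaves the states up to `t` unchanged, so the earlier costs agree
      -- literally.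
      earlier : sumUpTo (cost ss′) t ≡ sumUpTo (cost (ss τ)) t
      earlier = sumUpTo-cong t λ {i} i<t →
        ≡.cong₂ (λ r r′ → stepCost r r′ (suc i)) (old (ℕ.<⇒≤ i<t)) (old i<t)

      latest : cost ss′ t ≡ stepCost (x , y) (x′ , y′) (suc t)
      latest = ≡.cong₂ (λ r r′ → stepCost r r′ (suc t)) (≡.trans (old ℕ.≤-refl) (last-state τ)) new

      sum≤ : sumUpTo (cost ss′) (suc t) ≤ d + stepCost (x , y) (x′ , y′) (suc t)
      sum≤ = ≤-trans (≤-reflexive (sumUpTo-suc (cost ss′) t))
        (+-mono-≤ (≡.subst (_≤ d) (≡.sym earlier) (cost≤ τ)) (≤-reflexive (reflexive latest)))

    trajectory : ∀ {x y t us d} → Path ⟨ x , y , t ⟩ us d → t ℕ.≤ T → Trajectory x y t us d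
    trajectory [] _ = record
      { ss = [] ; length-ss = refl ; last-state = refl ; vertices = refl
      ; adequate = λ { (suc _) _ () } ; cost≤ = ≤-refl }
    trajectory (_▷_ {⟨ x′ , y′ , t′ ⟩} path e∈) t≤T with All.lookup (graph-sound) e∈
    -- A vertex at time `suc T` contradicts `t ≤ T`; `origin` is excluded because an edge raises the
    -- time.
    ... | _ , final , _ , _ = contradiction t≤T ℕ.1+n≰n
    ... | _ , slot {x} {y} s a≤x _ y≤N , refl , refl =
      ≡.subst (λ w → Trajectory x y (suc t′) _ (_ + w)) (≡.sym (edgeWeight-slot x′ y′ t′ x y s))
        (trajectory-∷ʳ (trajectory path (ℕ.<⇒≤ t≤T)) s a≤x y≤N)

    record CompleteTrajectory (us : List Vertex) (d : Carrier) : Set (c ⊔ ℓ₂) where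
      field
        ss        : List State
        length-ss : length ss ≡ T
        vertices  : reverse (⟨ 0 , 0 , suc T ⟩ ∷ us) ≡ ⟨ 0 , 0 , 0 ⟩ ∷ stamp 0 ss ∷ʳ ⟨ 0 , 0 , suc T ⟩
        feasible  : Feasible (serversAt ss) (generatorsAt ss)
        cost≤     : objective (serversAt ss) (generatorsAt ss) ≤ d

    complete-trajectory : ∀ {us d} → Path ⟨ 0 , 0 , suc T ⟩ us d → CompleteTrajectory us d
    complete-trajectory (_▷_ {⟨ x , y , t ⟩} {us} {d} path e∈) with All.lookup graph-sound e∈
    ... | _ , slot (_ , 1+T≤T) _ _ _ , _ , _ = contradiction 1+T≤T ℕ.1+n≰n
    -- The equation between times forces `t` to be `T`, so the path before the last edge covers
    -- exactly the slots.
    ... | _ , final , refl , refl = record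
      { ss        = ss τ
      ; length-ss = length-ss τ
      ; vertices  = ≡.trans (List.unfold-reverse _ (⟨ x , y , t ⟩ ∷ us)) (≡.cong (_∷ʳ _) (vertices τ))
      ; feasible  = record
        { x₀≡0 = refl ; y₀≡0 = refl
        ; x≥a  = λ k (1≤k , k≤T) → proj₁ (adequate τ k 1≤k k≤T)
        ; y≤N  = λ k (1≤k , k≤T) → proj₂ (adequate τ k 1≤k k≤T)
        }
      ; cost≤     = ≤-trans (cost≤ τ) (x≤x+y d (weight-nonNegative e∈))
      }
      where τ = trajectory path ℕ.≤-refl

    -- From schedules to paths

    module _ {x y : ℕ → ℕ} (feasible : Feasible x y) where

      open Feasible feasible

      at : ℕ → Vertex
      at t = ⟨ x t ⊓ M , y t , t ⟩

      at-0 : at 0 ≡ ⟨ 0 , 0 , 0 ⟩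
      at-0 rewrite x₀≡0 | y₀≡0 = refl

      at-inLayer : ∀ {t} → t ℕ.≤ T → InLayer (at t)
      at-inLayer {zero}  _   = ≡.subst InLayer (≡.sym at-0) origin
      at-inLayer {suc t} t<T = slot s a≤x⊓M (ℕ.m⊓n≤n _ M) (y≤N _ s)
        where
        s : Slot (suc t)
        s = ℕ.s≤s ℕ.z≤n , t<T
        a≤x⊓M : a (suc t) ≤ fromℕ (x (suc t) ⊓ M)
        -- The minimum is one of `x (suc t)` and `M`, and each of them suffices for the workload.
        a≤x⊓M with ℕ.⊓-sel (x (suc t)) M
        ... | inj₁ eq = ≡.subst (λ k → a (suc t) ≤ fromℕ k) (≡.sym eq) (x≥a _ s)
        ... | inj₂ eq = ≡.subst (λ k → a (suc t) ≤ fromℕ k) (≡.sym eq) (a≤M s)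

      path-to : ∀ {t} → t ℕ.≤ T → ∃[ us ] ∃[ d ] Path (at t) us d × d ≤ sumUpTo (costs x y) t
      path-to {zero} _ = [] , 0# , ≡.subst (λ u → Path u [] 0#) (≡.sym at-0) [] , ≤-refl
      path-to {suc t} t<T with path-to (ℕ.<⇒≤ t<T)
      ... | us , d′ , path , d′≤ = at t ∷ us , d′ + edgeWeight (at t) (at (suc t)) ,
        path ▷ graph-complete (at-inLayer (ℕ.<⇒≤ t<T)) (at-inLayer t<T) refl ,
        (begin
          d′ + edgeWeight (at t) (at (suc t))
            ≈⟨ +-congˡ (reflexive (edgeWeight-slot (x t ⊓ M) (y t) t (x (suc t) ⊓ M) (y (suc t)) s)) ⟩
          d′ + stepCost (x t ⊓ M , y t) (x (suc t) ⊓ M , y (suc t)) (suc t)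
            ≤⟨ +-mono-≤ d′≤ (stepCost-truncated s (x t) (y t) (x (suc t)) (y (suc t))) ⟩
          sumUpTo (costs x y) t + costs x y t          ≈⟨ sumUpTo-suc (costs x y) t ⟨
          sumUpTo (costs x y) (suc t)                  ∎)
        where
        open ≤-Reasoning
        s : Slot (suc t)
        s = ℕ.s≤s ℕ.z≤n , t<T

      complete-path : ∃[ us ] ∃[ d ] Path ⟨ 0 , 0 , suc T ⟩ us d × d ≤ objective x y
      complete-path with path-to ℕ.≤-refl
      ... | us , d′ , path , d′≤ = at T ∷ us , d′ + edgeWeight (at T) ⟨ 0 , 0 , suc T ⟩ ,
        path ▷ graph-complete (at-inLayer ℕ.≤-refl) final refl ,
        ≤-trans (≤-reflexive (trans (+-congˡ (reflexive (edgeWeight-final (at T)))) (+-identityʳ d′))) d′≤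

    -- Running `M` servers in every slot is always possible, so the goal is reachable and the search
    -- cannot fail.
    maximal-feasible : Feasible (λ { zero → 0 ; (suc _) → M }) (λ _ → 0)
    maximal-feasible = record
      { x₀≡0 = refl ; y₀≡0 = refl ; x≥a = λ { (suc _) s → a≤M s } ; y≤N = λ _ _ → ℕ.z≤n }

    reachable : ∃[ us ] ∃[ d ] Path ⟨ 0 , 0 , suc T ⟩ us d
    reachable = let us , d′ , path , _ = complete-path maximal-feasible in us , d′ , path

    value-states : ∀ t ss → value (states (stamp t ss)) ≡ ss
    value-states t []       = refl
    value-states t (s ∷ ss) = ≡.cong (s ∷_) (value-states (suc t) ss)

    steps-states : ∀ us → steps (states us) ≡ suc (length us)
    steps-states []                  = refl
    steps-states (⟨ x , y , _ ⟩ ∷ us) = ≡.cong suc (≡.trans (ℕ.+-identityʳ _) (steps-states us))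

    value-interior : ∀ u ss w → value (interior (just (u ∷ stamp 0 ss ∷ʳ w))) ≡ just ss
    value-interior u ss w rewrite value-dropLast (stamp 0 ss) w = ≡.cong just (value-states 0 ss)

    steps-interior : ∀ u us w → steps (interior (just (u ∷ us ∷ʳ w))) ≡ 3 ℕ.+ 2 ℕ.* length us
    steps-interior u us w rewrite value-dropLast us w = begin
      suc (steps (dropLast (us ∷ʳ w)) ℕ.+ (steps (states us) ℕ.+ 0))
        ≡⟨ ≡.cong₂ (λ i j → suc (i ℕ.+ (j ℕ.+ 0))) (steps-dropLast us w) (steps-states us) ⟩
      suc (suc (length us) ℕ.+ (suc (length us) ℕ.+ 0))
        ≡⟨ arrange (length us) ⟩
      3 ℕ.+ 2 ℕ.* length us  ∎
      where
      open ≡.≡-Reasoning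
      arrange : ∀ n → suc (suc n ℕ.+ (suc n ℕ.+ 0)) ≡ 3 ℕ.+ 2 ℕ.* n
      arrange = solve-∀

    -- Optimality and running time of the algorithm

    K : ℕ
    K = edgeBound M N T

    open FindsShortest

    search : Timed (Maybe (List Vertex))
    search = dijkstra (S ℕ.* (2 ℕ.+ T)) edges ⟨ 0 , 0 , 0 ⟩ ⟨ 0 , 0 , suc T ⟩

    search-correct : FindsShortest edges ⟨ 0 , 0 , 0 ⟩ ⟨ 0 , 0 , suc T ⟩ weight-nonNegative search _
    search-correct = dijkstra-correct edges ⟨ 0 , 0 , 0 ⟩ ⟨ 0 , 0 , suc T ⟩ weight-nonNegative
      (S ℕ.* (2 ℕ.+ T)) reachable

    open CompleteTrajectory (complete-trajectory (walk search-correct))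
      renaming (ss to ssₒ; length-ss to length-ssₒ; vertices to verticesₒ; feasible to feasibleₒ; cost≤ to costₒ≤)

    found-path : value search
      ≡ just (⟨ 0 , 0 , 0 ⟩ ∷ stamp 0 ssₒ ∷ʳ ⟨ 0 , 0 , suc T ⟩)
    found-path = ≡.trans (found search-correct) (≡.cong just verticesₒ)

    algorithm-optimal : ∃[ ss ] (value algorithm ≡ just ss × length ss ≡ T ×
                                 Optimal (serversAt ss) (generatorsAt ss))
    algorithm-optimal = ssₒ ,
      ≡.trans (≡.cong (λ path → value (interior path)) found-path)
        (value-interior ⟨ 0 , 0 , 0 ⟩ ssₒ ⟨ 0 , 0 , suc T ⟩) ,
      length-ssₒ ,
      record { feasible = feasibleₒ ; minimal = minimal }
      where
      minimal : ∀ x y → Feasible x y → objective (serversAt ssₒ) (generatorsAt ssₒ) ≤ objective x y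
      minimal x y feasible =
        let _ , _ , path , d≤ = complete-path feasible
        in ≤-trans costₒ≤ (≤-trans (shortest search-correct path) d≤)

    K≥1 : 1 ℕ.≤ K
    K≥1 = ℕ.s≤s ℕ.z≤n

    1+T≤K : suc T ℕ.≤ K
    1+T≤K = ℕ.m≤m*n (suc T) (S ℕ.* S)

    -- The 46 is 14 for building the graph, 8 for arrays and edge list, and 24 = 3 · 8 from `κ`,
    -- whose logarithm contributes 12 = 3 · 4. The remaining 3 T + 11 steps are 3 (T + 1) + 8, at
    -- most 11 `K`.
    steps-algorithm : steps algorithm ℕ.≤ K ℕ.* (57 ℕ.+ 12 ℕ.* ⌊log₂ (2 ℕ.+ K) ⌋)
    steps-algorithm = begin
      suc (steps graph ℕ.+ (steps search ℕ.+ steps (interior (value search))))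
        ≤⟨ ℕ.s≤s (ℕ.+-mono-≤ steps-graph (ℕ.+-mono-≤ (fast search-correct) (ℕ.≤-reflexive interior≡))) ⟩
      bound (suc (length (us search-correct)))
        ≡⟨ ≡.cong bound length-path ⟩
      bound (2 ℕ.+ T)
        ≤⟨ ℕ.s≤s (ℕ.+-monoʳ-≤ (suc T ℕ.* (14 ℕ.* (S ℕ.* S))) (ℕ.+-monoˡ-≤ (3 ℕ.+ 2 ℕ.* T) (ℕ.+-monoˡ-≤ (2 ℕ.+ T)
             (ℕ.+-mono-≤ (ℕ.+-monoˡ-≤ 5 (ℕ.+-mono-≤ (ℕ.*-monoʳ-≤ 2 z≤2K) (ℕ.*-monoʳ-≤ 4 length-edges)))
               (ℕ.*-mono-≤ (ℕ.+-mono-≤ (ℕ.*-monoʳ-≤ 2 length-edges) K≥1)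
                 (ℕ.+-monoʳ-≤ 8 (ℕ.*-monoʳ-≤ 4 (⌊log₂⌋-mono-≤ (ℕ.+-monoʳ-≤ 2 length-edges))))))))) ⟩
      suc (suc T ℕ.* (14 ℕ.* (S ℕ.* S)) ℕ.+
        (2 ℕ.* (2 ℕ.* K) ℕ.+ 4 ℕ.* K ℕ.+ 5 ℕ.+ (2 ℕ.* K ℕ.+ K) ℕ.* (8 ℕ.+ 4 ℕ.* ℓ) ℕ.+ (2 ℕ.+ T) ℕ.+ (3 ℕ.+ 2 ℕ.* T)))
        ≡⟨ arrange T (S ℕ.* S) ℓ ⟩
      K ℕ.* (46 ℕ.+ 12 ℕ.* ℓ) ℕ.+ (3 ℕ.* suc T ℕ.+ 8 ℕ.* 1)
        ≤⟨ ℕ.+-monoʳ-≤ (K ℕ.* (46 ℕ.+ 12 ℕ.* ℓ)) (ℕ.+-mono-≤ (ℕ.*-monoʳ-≤ 3 1+T≤K) (ℕ.*-monoʳ-≤ 8 K≥1)) ⟩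
      K ℕ.* (46 ℕ.+ 12 ℕ.* ℓ) ℕ.+ (3 ℕ.* K ℕ.+ 8 ℕ.* K)
        ≡⟨ collect K ℓ ⟩
      K ℕ.* (57 ℕ.+ 12 ℕ.* ℓ)  ∎
      where
      open ℕ.≤-Reasoning
      z = S ℕ.* (2 ℕ.+ T)
      E = length edges
      ℓ = ⌊log₂ (2 ℕ.+ K) ⌋

      bound : ℕ → ℕ
      bound len = suc (suc T ℕ.* (14 ℕ.* (S ℕ.* S)) ℕ.+
        (2 ℕ.* z ℕ.+ 4 ℕ.* E ℕ.+ 5 ℕ.+ (2 ℕ.* E ℕ.+ 1) ℕ.* (8 ℕ.+ 4 ℕ.* ⌊log₂ (2 ℕ.+ E) ⌋) ℕ.+ len
          ℕ.+ (3 ℕ.+ 2 ℕ.* T)))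

      length-stamp-ssₒ : length (stamp 0 ssₒ) ≡ T
      length-stamp-ssₒ = ≡.trans (length-stamp 0 ssₒ) length-ssₒ

      length-path : suc (length (us search-correct)) ≡ 2 ℕ.+ T
      length-path = begin-equality
        suc (length (us search-correct))
          ≡⟨ List.length-reverse (⟨ 0 , 0 , suc T ⟩ ∷ us search-correct) ⟨
        length (reverse (⟨ 0 , 0 , suc T ⟩ ∷ us search-correct))
          ≡⟨ ≡.cong length verticesₒ ⟩
        suc (length (stamp 0 ssₒ ∷ʳ ⟨ 0 , 0 , suc T ⟩))
          ≡⟨ ≡.cong suc (List.length-++ (stamp 0 ssₒ)) ⟩
        suc (length (stamp 0 ssₒ) ℕ.+ 1)
          ≡⟨ ≡.cong (λ k → suc (k ℕ.+ 1)) length-stamp-ssₒ ⟩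
        suc (T ℕ.+ 1)                                             ≡⟨ ≡.cong suc (ℕ.+-comm T 1) ⟩
        2 ℕ.+ T                                                   ∎

      interior≡ : steps (interior (value search)) ≡ 3 ℕ.+ 2 ℕ.* T
      interior≡ = ≡.trans (≡.cong (λ path → steps (interior path)) found-path)
        (≡.trans (steps-interior ⟨ 0 , 0 , 0 ⟩ (stamp 0 ssₒ) ⟨ 0 , 0 , suc T ⟩)
          (≡.cong (λ k → 3 ℕ.+ 2 ℕ.* k) length-stamp-ssₒ))

      z≤2K : z ℕ.≤ 2 ℕ.* K
      z≤2K = begin
        S ℕ.* (2 ℕ.+ T)
          ≤⟨ ℕ.*-mono-≤ (ℕ.m≤m*n S S) (ℕ.+-monoʳ-≤ 2 (ℕ.m≤m+n T _)) ⟩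
        S ℕ.* S ℕ.* (2 ℕ.+ 2 ℕ.* T)           ≡⟨ commute (S ℕ.* S) T ⟩
        2 ℕ.* K                               ∎
        where
        commute : ∀ r t → r ℕ.* (2 ℕ.+ 2 ℕ.* t) ≡ 2 ℕ.* (suc t ℕ.* r)
        commute = solve-∀

      arrange : ∀ t r l → suc (suc t ℕ.* (14 ℕ.* r) ℕ.+
          (2 ℕ.* (2 ℕ.* (suc t ℕ.* r)) ℕ.+ 4 ℕ.* (suc t ℕ.* r) ℕ.+ 5
            ℕ.+ (2 ℕ.* (suc t ℕ.* r) ℕ.+ suc t ℕ.* r) ℕ.* (8 ℕ.+ 4 ℕ.* l) ℕ.+ (2 ℕ.+ t) ℕ.+ (3 ℕ.+ 2 ℕ.* t)))
        ≡ suc t ℕ.* r ℕ.* (46 ℕ.+ 12 ℕ.* l) ℕ.+ (3 ℕ.* suc t ℕ.+ 8 ℕ.* 1)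
      arrange = solve-∀
      collect : ∀ k l → k ℕ.* (46 ℕ.+ 12 ℕ.* l) ℕ.+ (3 ℕ.* k ℕ.+ 8 ℕ.* k) ≡ k ℕ.* (57 ℕ.+ 12 ℕ.* l)
      collect = solve-∀

open import Data.Nat.Base using (_≤_; _*_; _^_)

-- `C` is chosen before the instance `P`, so one constant serves all inputs. For M N T equal to 0 or
-- 1 the right-hand side of the time bound vanishes, while the algorithm always takes at least one
-- step; hence the restriction to 2 ≤ M N T.
theorem1 : ∀ {c ℓ₁ ℓ₂} (F : ArchimedeanOrderedField c ℓ₁ ℓ₂) →
  ∃[ C ] ((P : DataCentre.DCM F) →
    let open DataCentre F
        open DCM P in
    (∃[ ss ] (value algorithm ≡ just ss × length ss ≡ T ×
              Optimal (serversAt ss) (generatorsAt ss)))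
    × (2 ≤ M * N * T →
       steps algorithm ≤ C * (M ^ 2 * N ^ 2 * T * ⌊log₂ (M * N * T) ⌋)))
theorem1 F = 22080 , λ P →
  let open DataCentre.DCM P using (M; N; T)
      open DataCentreProperties F using (algorithm-optimal; steps-algorithm)
  in algorithm-optimal P ,
     λ 2≤MNT → ℕ.≤-trans (steps-algorithm P) (steps-bound {M} {N} {T} 2≤MNT)
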